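{- Let $d, n$ be positive integers and let $X_1,\ldots,X_{n-1}\subseteq\mathbb{R}^d$ be 1-dense sets. Then there exist a tuple $(p_0,\ldots,p_n)$ of points of $\mathbb{R}^d$ and a vector $s\in\mathbb{R}^d$ such that $p_0=p_n=\underline{0}$, $p_i\in X_i$ for all $1\le i\le n-1$, and $\|(p_{i+1}-p_i)-s\|\le\sqrt{2}$ for all $0\le i\le n-1$.
   Context: $\|\cdot\|$ is the Euclidean norm on $\mathbb{R}^d$, $\underline{0}$ is the origin, and $\operatorname{dist}$ is Euclidean distance. A set $X\subseteq\mathbb{R}^d$ is called 1-dense if $\operatorname{dist}(y,X)<1$ for every $y\in\mathbb{R}^d$ (equivalently, $X$ intersects every open unit ball). -}

module Defs where

open import Level using (0ℓ)
open import Data.Nat as ℕ using (ℕ; zero; suc)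
import Data.Nat.Properties as ℕₚ
open import Data.Nat.Coprimality using (sym; 1-coprimeTo)
open import Data.Integer as ℤ using (+_)
import Data.Integer.Properties as ℤₚ
open import Data.Rational as ℚ using (ℚ; mkℚ; 0ℚ; 1ℚ; ½; *≤*; *<*)
import Data.Rational.Properties as ℚₚ
import Data.Rational.Unnormalised as ℚᵘ
import Data.Rational.Unnormalised.Properties as ℚᵘₚ
open import Data.Rational.Solver using (module +-*-Solver)
open +-*-Solver using (solve; _:+_; _:*_; _:-_; :-_; _:=_; con)
open import Data.Vec.Functional using (Vector; foldr)
open import Data.Product using (_×_; _,_; proj₁; proj₂; ∃-syntax)
open import Data.Sum using (inj₁; inj₂)
open import Relation.Nullary using (yes; no; contradiction)
open import Relation.Unary using (Pred)
open import Relation.Binary.Definitions using (_Respects_)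
open import Relation.Binary.PropositionalEquality
  using (_≡_; refl; cong; subst; trans; module ≡-Reasoning)
  renaming (sym to ≡-sym)

-- Cauchy sequences of rationals; equality of reals is _≈_, not _≡_.

record ℝ : Set where
  constructor real
  field
    seq    : ℕ → ℚ
    cauchy : ∀ ε → 0ℚ ℚ.< ε →
             ∃[ N ] ∀ m n → N ℕ.≤ m → N ℕ.≤ n → ℚ.∣ seq m ℚ.- seq n ∣ ℚ.< ε

open ℝ public

infix 4 _≈_ _≤_ _<_

_≈_ : ℝ → ℝ → Set
x ≈ y = ∀ ε → 0ℚ ℚ.< ε → ∃[ N ] ∀ n → N ℕ.≤ n → ℚ.∣ seq x n ℚ.- seq y n ∣ ℚ.< ε

_≤_ : ℝ → ℝ → Set
x ≤ y = ∀ ε → 0ℚ ℚ.< ε → ∃[ N ] ∀ n → N ℕ.≤ n → seq x n ℚ.< seq y n ℚ.+ ε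

_<_ : ℝ → ℝ → Set
x < y = ∃[ ε ] (0ℚ ℚ.< ε × ∃[ N ] ∀ n → N ℕ.≤ n → seq x n ℚ.+ ε ℚ.< seq y n)

module RationalLemmas where

  ∣p∣<q : ∀ {p q} → p ℚ.< q → ℚ.- p ℚ.< q → ℚ.∣ p ∣ ℚ.< q
  ∣p∣<q {p} {q} p<q -p<q with ℚₚ.∣p∣≡p∨∣p∣≡-p p
  ... | inj₁ e = subst (ℚ._< q) (≡-sym e) p<q
  ... | inj₂ e = subst (ℚ._< q) (≡-sym e) -p<q

  p≤∣p∣ : ∀ p → p ℚ.≤ ℚ.∣ p ∣
  p≤∣p∣ p with ℚₚ.≤-total 0ℚ p
  ... | inj₁ 0≤p = ℚₚ.≤-reflexive (≡-sym (ℚₚ.0≤p⇒∣p∣≡p 0≤p))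
  ... | inj₂ p≤0 = ℚₚ.≤-trans p≤0 (ℚₚ.0≤∣p∣ p)

  ∣p-q∣≡∣q-p∣ : ∀ p q → ℚ.∣ p ℚ.- q ∣ ≡ ℚ.∣ q ℚ.- p ∣
  ∣p-q∣≡∣q-p∣ p q = trans (≡-sym (ℚₚ.∣-p∣≡∣p∣ (p ℚ.- q)))
    (cong ℚ.∣_∣ (solve 2 (λ p q → :- (p :- q) := q :- p) refl p q))

  half-pos : ∀ {ε} → 0ℚ ℚ.< ε → 0ℚ ℚ.< ½ ℚ.* ε
  half-pos {ε} 0<ε = subst (ℚ._< ½ ℚ.* ε) (ℚₚ.*-zeroʳ ½) (ℚₚ.*-monoʳ-<-pos ½ 0<ε)

  half+half : ∀ ε → ½ ℚ.* ε ℚ.+ ½ ℚ.* ε ≡ ε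
  half+half = solve 1 (λ ε → con ½ :* ε :+ con ½ :* ε := ε) refl

  *-pos : ∀ {p q} → 0ℚ ℚ.< p → 0ℚ ℚ.< q → 0ℚ ℚ.< p ℚ.* q
  *-pos {p} {q} 0<p 0<q = subst (ℚ._< p ℚ.* q) (ℚₚ.*-zeroʳ p)
    (ℚₚ.*-monoʳ-<-pos p {{ℚ.positive 0<p}} 0<q)

  *-nonNeg : ∀ {p q} → 0ℚ ℚ.≤ p → 0ℚ ℚ.≤ q → 0ℚ ℚ.≤ p ℚ.* q
  *-nonNeg {p} {q} 0≤p 0≤q = subst (ℚ._≤ p ℚ.* q) (ℚₚ.*-zeroʳ p)
    (ℚₚ.*-monoˡ-≤-nonNeg p {{ℚ.nonNegative 0≤p}} 0≤q)

  *-mono-≤ : ∀ {p q r s} → 0ℚ ℚ.≤ p → 0ℚ ℚ.≤ s → p ℚ.≤ q → r ℚ.≤ s → p ℚ.* r ℚ.≤ q ℚ.* s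
  *-mono-≤ {p} {q} {r} {s} 0≤p 0≤s p≤q r≤s = ℚₚ.≤-trans
    (ℚₚ.*-monoˡ-≤-nonNeg p {{ℚ.nonNegative 0≤p}} r≤s)
    (ℚₚ.*-monoʳ-≤-nonNeg s {{ℚ.nonNegative 0≤s}} p≤q)

  quotient : ∀ ε b → 0ℚ ℚ.< ε → 0ℚ ℚ.< b → ∃[ δ ] (0ℚ ℚ.< δ × b ℚ.* δ ≡ ε)
  quotient ε b 0<ε 0<b = 1/b ℚ.* ε , *-pos 0<1/b 0<ε , eq
    where
    instance
      b-pos : ℚ.Positive b
      b-pos = ℚ.positive 0<b
      b-nonZero : ℚ.NonZero b
      b-nonZero = ℚₚ.pos⇒nonZero b
    1/b = ℚ.1/ b
    0<1/b : 0ℚ ℚ.< 1/b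
    0<1/b = ℚₚ.positive⁻¹ 1/b {{ℚₚ.1/pos⇒pos b}}
    eq : b ℚ.* (1/b ℚ.* ε) ≡ ε
    eq = trans (≡-sym (ℚₚ.*-assoc b 1/b ε))
               (trans (cong (ℚ._* ε) (ℚₚ.*-inverseʳ b)) (ℚₚ.*-identityˡ ε))

  fromℕ : ℕ → ℚ
  fromℕ n = mkℚ (+ n) 0 (sym (1-coprimeTo n))

  fromℕ-suc : ∀ n → fromℕ (suc n) ≡ 1ℚ ℚ.+ fromℕ n
  fromℕ-suc n = ℚₚ.toℚᵘ-injective (ℚᵘₚ.≃-trans
    (ℚᵘ.*≡* (cong (λ k → (+ 1 ℤ.+ k) ℤ.* + 1) (≡-sym (ℤₚ.*-identityʳ (+ n)))))
    (ℚᵘₚ.≃-sym (ℚₚ.toℚᵘ-homo-+ 1ℚ (fromℕ n))))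

  fromℕ-mono : ∀ {m n} → m ℕ.≤ n → fromℕ m ℚ.≤ fromℕ n
  fromℕ-mono m≤n = *≤* (ℤₚ.*-monoʳ-≤-nonNeg (+ 1) (ℤ.+≤+ m≤n))

  archimedean : ∀ p → ∃[ n ] (p ℚ.≤ fromℕ n)
  archimedean p@(mkℚ (+ n) d-1 _) = n , *≤*
    (ℤₚ.*-monoˡ-≤-nonNeg (+ n) (ℤ.+≤+ (ℕ.s≤s ℕ.z≤n)))
  archimedean p@(mkℚ (ℤ.-[1+ n ]) d-1 _) = 0 , *≤* ℤ.-≤+

open RationalLemmas

halves : ℕ → ℚ
halves zero    = 1ℚ
halves (suc n) = ½ ℚ.* halves n

module BoundLemmas where

  halves-pos : ∀ n → 0ℚ ℚ.< halves n
  halves-pos zero    = *<* (ℤ.+<+ (ℕ.s≤s ℕ.z≤n))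
  halves-pos (suc n) = half-pos (halves-pos n)

  halves-bound : ∀ n → (1ℚ ℚ.+ fromℕ n) ℚ.* halves n ℚ.≤ 1ℚ
  halves-bound zero    = ℚₚ.≤-refl
  halves-bound (suc n) = begin
    (1ℚ ℚ.+ fromℕ (suc n)) ℚ.* (½ ℚ.* h)
      ≡⟨ cong (λ k → (1ℚ ℚ.+ k) ℚ.* (½ ℚ.* h)) (fromℕ-suc n) ⟩
    (1ℚ ℚ.+ (1ℚ ℚ.+ k)) ℚ.* (½ ℚ.* h)
      ≡⟨ solve 2 (λ k h → (con 1ℚ :+ (con 1ℚ :+ k)) :* (con ½ :* h)
           := h :+ k :* (con ½ :* h)) refl k h ⟩
    h ℚ.+ k ℚ.* (½ ℚ.* h)
      ≤⟨ ℚₚ.+-monoʳ-≤ h (ℚₚ.*-monoˡ-≤-nonNeg k ½h≤h) ⟩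
    h ℚ.+ k ℚ.* h
      ≡⟨ solve 2 (λ k h → h :+ k :* h := (con 1ℚ :+ k) :* h) refl k h ⟩
    (1ℚ ℚ.+ k) ℚ.* h
      ≤⟨ halves-bound n ⟩
    1ℚ ∎
    where
    open ℚₚ.≤-Reasoning
    h = halves n
    k = fromℕ n
    ½h≤h : ½ ℚ.* h ℚ.≤ h
    ½h≤h = subst (½ ℚ.* h ℚ.≤_) (half+half h)
      (subst (ℚ._≤ ½ ℚ.* h ℚ.+ ½ ℚ.* h) (ℚₚ.+-identityʳ (½ ℚ.* h))
        (ℚₚ.+-monoʳ-≤ (½ ℚ.* h) (ℚₚ.<⇒≤ (half-pos (halves-pos n)))))

  halves→0 : ∀ b ε → 0ℚ ℚ.< b → 0ℚ ℚ.< ε →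
             ∃[ N ] ∀ n → N ℕ.≤ n → b ℚ.* halves n ℚ.< ε
  halves→0 b ε 0<b 0<ε with quotient b ε 0<b 0<ε
  ... | r , _ , εr≡b with archimedean r
  ... | N , r≤N = N , λ n N≤n → begin-strict
    b ℚ.* halves n
      ≡⟨ cong (ℚ._* halves n) (≡-sym εr≡b) ⟩
    (ε ℚ.* r) ℚ.* halves n
      ≡⟨ ℚₚ.*-assoc ε r (halves n) ⟩
    ε ℚ.* (r ℚ.* halves n)
      <⟨ ℚₚ.*-monoʳ-<-pos ε {{ℚ.positive 0<ε}} (rh<1 n N≤n) ⟩
    ε ℚ.* 1ℚ
      ≡⟨ ℚₚ.*-identityʳ ε ⟩
    ε ∎
    where
    open ℚₚ.≤-Reasoning
    rh<1 : ∀ n → N ℕ.≤ n → r ℚ.* halves n ℚ.< 1ℚ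
    rh<1 n N≤n = begin-strict
      r ℚ.* h               ≤⟨ ℚₚ.*-monoʳ-≤-nonNeg h {{h≥0}} (ℚₚ.≤-trans r≤N (fromℕ-mono N≤n)) ⟩
      k ℚ.* h               ≡⟨ ≡-sym (ℚₚ.+-identityˡ (k ℚ.* h)) ⟩
      0ℚ ℚ.+ k ℚ.* h        <⟨ ℚₚ.+-monoˡ-< (k ℚ.* h) (halves-pos n) ⟩
      h ℚ.+ k ℚ.* h         ≡⟨ solve 2 (λ k h → h :+ k :* h := (con 1ℚ :+ k) :* h) refl k h ⟩
      (1ℚ ℚ.+ k) ℚ.* h      ≤⟨ halves-bound n ⟩
      1ℚ                    ∎
      where
      h = halves n
      k = fromℕ n
      h≥0 = ℚ.nonNegative (ℚₚ.<⇒≤ (halves-pos n))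

  bounded : ∀ x → ∃[ b ] (0ℚ ℚ.< b × ∃[ N ] ∀ n → N ℕ.≤ n → ℚ.∣ seq x n ∣ ℚ.< b)
  bounded x with cauchy x 1ℚ (*<* (ℤ.+<+ (ℕ.s≤s ℕ.z≤n)))
  ... | N , close = 1ℚ ℚ.+ ℚ.∣ c ∣ , 0<b , N , λ n N≤n → begin-strict
    ℚ.∣ seq x n ∣                       ≡⟨ cong ℚ.∣_∣ (solve 2 (λ a c → a := (a :- c) :+ c) refl (seq x n) c) ⟩
    ℚ.∣ (seq x n ℚ.- c) ℚ.+ c ∣         ≤⟨ ℚₚ.∣p+q∣≤∣p∣+∣q∣ (seq x n ℚ.- c) c ⟩
    ℚ.∣ seq x n ℚ.- c ∣ ℚ.+ ℚ.∣ c ∣     <⟨ ℚₚ.+-monoˡ-< ℚ.∣ c ∣ (close n N N≤n ℕₚ.≤-refl) ⟩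
    1ℚ ℚ.+ ℚ.∣ c ∣                      ∎
    where
    open ℚₚ.≤-Reasoning
    c = seq x N
    0<b : 0ℚ ℚ.< 1ℚ ℚ.+ ℚ.∣ c ∣
    0<b = ℚₚ.+-mono-<-≤ {0ℚ} {1ℚ} {0ℚ} (*<* (ℤ.+<+ (ℕ.s≤s ℕ.z≤n))) (ℚₚ.0≤∣p∣ c)

open BoundLemmas

fromℚ : ℚ → ℝ
fromℚ q = real (λ _ → q) λ ε 0<ε → 0 , λ _ _ _ _ →
  subst (ℚ._< ε) (cong ℚ.∣_∣ (≡-sym (ℚₚ.+-inverseʳ q))) 0<ε

0ℝ 1ℝ 2ℝ : ℝ
0ℝ = fromℚ 0ℚ
1ℝ = fromℚ 1ℚ
2ℝ = fromℚ (1ℚ ℚ.+ 1ℚ)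

infixl 6 _+_ _-_
infixl 7 _*_
infix  8 -_

-_ : ℝ → ℝ
- x = real (λ n → ℚ.- seq x n) λ ε 0<ε →
  let N , close = cauchy x ε 0<ε in N , λ m n N≤m N≤n →
  subst (ℚ._< ε) (eq (seq x m) (seq x n)) (close n m N≤n N≤m)
  where
  eq : ∀ p q → ℚ.∣ q ℚ.- p ∣ ≡ ℚ.∣ ℚ.- p ℚ.- ℚ.- q ∣
  eq p q = cong ℚ.∣_∣ (solve 2 (λ p q → q :- p := (:- p) :- (:- q)) refl p q)

_+_ : ℝ → ℝ → ℝ
x + y = real (λ n → seq x n ℚ.+ seq y n) λ ε 0<ε →
  let M , closeˣ = cauchy x (½ ℚ.* ε) (half-pos 0<ε)
      N , closeʸ = cauchy y (½ ℚ.* ε) (half-pos 0<ε)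
  in M ℕ.⊔ N , λ m n K≤m K≤n → begin-strict
    ℚ.∣ (seq x m ℚ.+ seq y m) ℚ.- (seq x n ℚ.+ seq y n) ∣
      ≡⟨ cong ℚ.∣_∣ (solve 4 (λ a b c d → (a :+ b) :- (c :+ d) := (a :- c) :+ (b :- d))
           refl (seq x m) (seq y m) (seq x n) (seq y n)) ⟩
    ℚ.∣ (seq x m ℚ.- seq x n) ℚ.+ (seq y m ℚ.- seq y n) ∣
      ≤⟨ ℚₚ.∣p+q∣≤∣p∣+∣q∣ (seq x m ℚ.- seq x n) (seq y m ℚ.- seq y n) ⟩
    ℚ.∣ seq x m ℚ.- seq x n ∣ ℚ.+ ℚ.∣ seq y m ℚ.- seq y n ∣
      <⟨ ℚₚ.+-mono-< (closeˣ m n (ℕₚ.m⊔n≤o⇒m≤o M N K≤m) (ℕₚ.m⊔n≤o⇒m≤o M N K≤n))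
                     (closeʸ m n (ℕₚ.m⊔n≤o⇒n≤o M N K≤m) (ℕₚ.m⊔n≤o⇒n≤o M N K≤n)) ⟩
    ½ ℚ.* ε ℚ.+ ½ ℚ.* ε
      ≡⟨ half+half ε ⟩
    ε ∎
  where open ℚₚ.≤-Reasoning

_-_ : ℝ → ℝ → ℝ
x - y = x + - y

_*_ : ℝ → ℝ → ℝ
x * y = real (λ n → seq x n ℚ.* seq y n) λ ε 0<ε →
  let A , 0<A , Nᵃ , ∣x∣<A = bounded x
      B , 0<B , Nᵇ , ∣y∣<B = bounded y
      δ , 0<δ , [A+B]δ≡ε  = quotient ε (A ℚ.+ B) 0<ε (ℚₚ.+-mono-< {0ℚ} {A} {0ℚ} 0<A 0<B)
      M , closeˣ = cauchy x δ 0<δ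
      N , closeʸ = cauchy y δ 0<δ
  in (Nᵃ ℕ.⊔ Nᵇ) ℕ.⊔ (M ℕ.⊔ N) , λ m n K≤m K≤n →
  let Kᵃᵇ≤m = ℕₚ.m⊔n≤o⇒m≤o (Nᵃ ℕ.⊔ Nᵇ) (M ℕ.⊔ N) K≤m
      Kᵃᵇ≤n = ℕₚ.m⊔n≤o⇒m≤o (Nᵃ ℕ.⊔ Nᵇ) (M ℕ.⊔ N) K≤n
      Kˣʸ≤m = ℕₚ.m⊔n≤o⇒n≤o (Nᵃ ℕ.⊔ Nᵇ) (M ℕ.⊔ N) K≤m
      Kˣʸ≤n = ℕₚ.m⊔n≤o⇒n≤o (Nᵃ ℕ.⊔ Nᵇ) (M ℕ.⊔ N) K≤n
      a  = seq x m
      a′ = seq x n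
      b  = seq y m
      b′ = seq y n
      a<  = ∣x∣<A m (ℕₚ.m⊔n≤o⇒m≤o Nᵃ Nᵇ Kᵃᵇ≤m)
      b′< = ∣y∣<B n (ℕₚ.m⊔n≤o⇒n≤o Nᵃ Nᵇ Kᵃᵇ≤n)
      aa′ = closeˣ m n (ℕₚ.m⊔n≤o⇒m≤o M N Kˣʸ≤m) (ℕₚ.m⊔n≤o⇒m≤o M N Kˣʸ≤n)
      bb′ = closeʸ m n (ℕₚ.m⊔n≤o⇒n≤o M N Kˣʸ≤m) (ℕₚ.m⊔n≤o⇒n≤o M N Kˣʸ≤n)
  in begin-strict
    ℚ.∣ a ℚ.* b ℚ.- a′ ℚ.* b′ ∣
      ≡⟨ cong ℚ.∣_∣ (solve 4 (λ a b c d → a :* b :- c :* d := a :* (b :- d) :+ d :* (a :- c))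
           refl a b a′ b′) ⟩
    ℚ.∣ a ℚ.* (b ℚ.- b′) ℚ.+ b′ ℚ.* (a ℚ.- a′) ∣
      ≤⟨ ℚₚ.∣p+q∣≤∣p∣+∣q∣ (a ℚ.* (b ℚ.- b′)) (b′ ℚ.* (a ℚ.- a′)) ⟩
    ℚ.∣ a ℚ.* (b ℚ.- b′) ∣ ℚ.+ ℚ.∣ b′ ℚ.* (a ℚ.- a′) ∣
      <⟨ ℚₚ.+-mono-< (product< 0<A 0<δ a< bb′) (product< 0<B 0<δ b′< aa′) ⟩
    A ℚ.* δ ℚ.+ B ℚ.* δ
      ≡⟨ ≡-sym (ℚₚ.*-distribʳ-+ δ A B) ⟩
    (A ℚ.+ B) ℚ.* δ
      ≡⟨ [A+B]δ≡ε ⟩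
    ε ∎
  where
  open ℚₚ.≤-Reasoning
  product< : ∀ {p q P Q} → 0ℚ ℚ.< P → 0ℚ ℚ.< Q →
             ℚ.∣ p ∣ ℚ.< P → ℚ.∣ q ∣ ℚ.< Q → ℚ.∣ p ℚ.* q ∣ ℚ.< P ℚ.* Q
  product< {p} {q} {P} {Q} 0<P 0<Q p<P q<Q = begin-strict
    ℚ.∣ p ℚ.* q ∣         ≡⟨ ℚₚ.∣p*q∣≡∣p∣*∣q∣ p q ⟩
    ℚ.∣ p ∣ ℚ.* ℚ.∣ q ∣   ≤⟨ ℚₚ.*-monoʳ-≤-nonNeg ℚ.∣ q ∣ {{ℚₚ.∣-∣-nonNeg q}} (ℚₚ.<⇒≤ p<P) ⟩
    P ℚ.* ℚ.∣ q ∣         <⟨ ℚₚ.*-monoʳ-<-pos P {{ℚ.positive 0<P}} q<Q ⟩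
    P ℚ.* Q               ∎

-- For 0 ≤ q, bisect q n is an interval [l , u] of length (1 + q) / 2ⁿ with
-- l² ≤ q < u², so its left end converges to the square root of q.

bisect : ℚ → ℕ → ℚ × ℚ
bisect q zero    = 0ℚ , 1ℚ ℚ.+ q
bisect q (suc n) with bisect q n
... | l , u with ½ ℚ.* (l ℚ.+ u)
... | m with m ℚ.* m ℚₚ.≤? q
... | yes _ = m , u
... | no  _ = l , m

record SqrtBracket (q : ℚ) (n : ℕ) (lu : ℚ × ℚ) : Set where
  constructor bracket
  l = proj₁ lu
  u = proj₂ lu
  field
    0≤l  : 0ℚ ℚ.≤ l
    l≤u  : l ℚ.≤ u
    l²≤q : l ℚ.* l ℚ.≤ q
    q<u² : q ℚ.< u ℚ.* u
    gap  : u ℚ.- l ≡ (1ℚ ℚ.+ q) ℚ.* halves n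

bisect-bracket : ∀ q → 0ℚ ℚ.≤ q → ∀ n → SqrtBracket q n (bisect q n)
bisect-bracket q 0≤q zero = bracket ℚₚ.≤-refl 0≤1+q 0≤q q<[1+q]²
  (solve 1 (λ q → (con 1ℚ :+ q) :- con 0ℚ := (con 1ℚ :+ q) :* con 1ℚ) refl q)
  where
  open ℚₚ.≤-Reasoning
  0<1 : 0ℚ ℚ.< 1ℚ
  0<1 = *<* (ℤ.+<+ (ℕ.s≤s ℕ.z≤n))
  0≤1+q : 0ℚ ℚ.≤ 1ℚ ℚ.+ q
  0≤1+q = ℚₚ.+-mono-≤ {0ℚ} {1ℚ} {0ℚ} (ℚₚ.<⇒≤ 0<1) 0≤q
  q<[1+q]² : q ℚ.< (1ℚ ℚ.+ q) ℚ.* (1ℚ ℚ.+ q)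
  q<[1+q]² = begin-strict
    q                                      ≡⟨ ≡-sym (ℚₚ.+-identityˡ q) ⟩
    0ℚ ℚ.+ q                               <⟨ ℚₚ.+-mono-<-≤ {0ℚ} {1ℚ ℚ.+ (q ℚ.+ q ℚ.* q)} 0<rest ℚₚ.≤-refl ⟩
    (1ℚ ℚ.+ (q ℚ.+ q ℚ.* q)) ℚ.+ q         ≡⟨ solve 1 (λ q → (con 1ℚ :+ (q :+ q :* q)) :+ q
                                                := (con 1ℚ :+ q) :* (con 1ℚ :+ q)) refl q ⟩
    (1ℚ ℚ.+ q) ℚ.* (1ℚ ℚ.+ q)              ∎
    where
    0<rest = ℚₚ.+-mono-<-≤ {0ℚ} {1ℚ} {0ℚ} 0<1
      (ℚₚ.+-mono-≤ {0ℚ} {q} {0ℚ} 0≤q (*-nonNeg 0≤q 0≤q))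
bisect-bracket q 0≤q (suc n) with bisect q n | bisect-bracket q 0≤q n
... | l , u | bracket 0≤l l≤u l²≤q q<u² gap
  with ½ ℚ.* (l ℚ.+ u) in m-def
... | m with m ℚ.* m ℚₚ.≤? q
... | yes m²≤q = bracket (ℚₚ.≤-trans 0≤l l≤m) m≤u m²≤q q<u² gap′
  where
  l≤m : l ℚ.≤ m
  l≤m = subst (l ℚ.≤_) m-def (subst (ℚ._≤ ½ ℚ.* (l ℚ.+ u))
    (trans (ℚₚ.*-distribˡ-+ ½ l l) (half+half l)) (ℚₚ.*-monoˡ-≤-nonNeg ½ (ℚₚ.+-monoʳ-≤ l l≤u)))
  m≤u : m ℚ.≤ u
  m≤u = subst (ℚ._≤ u) m-def (subst (½ ℚ.* (l ℚ.+ u) ℚ.≤_)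
    (trans (ℚₚ.*-distribˡ-+ ½ u u) (half+half u)) (ℚₚ.*-monoˡ-≤-nonNeg ½ (ℚₚ.+-monoˡ-≤ u l≤u)))
  gap′ : u ℚ.- m ≡ (1ℚ ℚ.+ q) ℚ.* (½ ℚ.* halves n)
  gap′ = begin
    u ℚ.- m                             ≡⟨ cong (λ k → u ℚ.- k) (≡-sym m-def) ⟩
    u ℚ.- ½ ℚ.* (l ℚ.+ u)               ≡⟨ solve 2 (λ l u → u :- con ½ :* (l :+ u) := con ½ :* (u :- l)) refl l u ⟩
    ½ ℚ.* (u ℚ.- l)                     ≡⟨ cong (½ ℚ.*_) gap ⟩
    ½ ℚ.* ((1ℚ ℚ.+ q) ℚ.* halves n)     ≡⟨ solve 2 (λ a h → con ½ :* (a :* h) := a :* (con ½ :* h)) refl (1ℚ ℚ.+ q) (halves n) ⟩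
    (1ℚ ℚ.+ q) ℚ.* (½ ℚ.* halves n)     ∎
    where open ≡-Reasoning
... | no m²≰q = bracket 0≤l l≤m l²≤q (ℚₚ.≰⇒> m²≰q) gap′
  where
  l≤m : l ℚ.≤ m
  l≤m = subst (l ℚ.≤_) m-def (subst (ℚ._≤ ½ ℚ.* (l ℚ.+ u))
    (trans (ℚₚ.*-distribˡ-+ ½ l l) (half+half l)) (ℚₚ.*-monoˡ-≤-nonNeg ½ (ℚₚ.+-monoʳ-≤ l l≤u)))
  gap′ : m ℚ.- l ≡ (1ℚ ℚ.+ q) ℚ.* (½ ℚ.* halves n)
  gap′ = begin
    m ℚ.- l                             ≡⟨ cong (λ k → k ℚ.- l) (≡-sym m-def) ⟩
    ½ ℚ.* (l ℚ.+ u) ℚ.- l               ≡⟨ solve 2 (λ l u → con ½ :* (l :+ u) :- l := con ½ :* (u :- l)) refl l u ⟩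
    ½ ℚ.* (u ℚ.- l)                     ≡⟨ cong (½ ℚ.*_) gap ⟩
    ½ ℚ.* ((1ℚ ℚ.+ q) ℚ.* halves n)     ≡⟨ solve 2 (λ a h → con ½ :* (a :* h) := a :* (con ½ :* h)) refl (1ℚ ℚ.+ q) (halves n) ⟩
    (1ℚ ℚ.+ q) ℚ.* (½ ℚ.* halves n)     ∎
    where open ≡-Reasoning

-- The n-th approximant of √x; negative rationals are replaced by 0, so
-- that √x ≈ 0 for negative x.
√-seq : (ℕ → ℚ) → ℕ → ℚ
√-seq a n = proj₁ (bisect (0ℚ ℚ.⊔ a n) n)

module BracketLemmas where

  ⊔-close : ∀ p q ε → 0ℚ ℚ.< ε → ℚ.∣ p ℚ.- q ∣ ℚ.< ε → 0ℚ ℚ.⊔ p ℚ.< (0ℚ ℚ.⊔ q) ℚ.+ ε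
  ⊔-close p q ε 0<ε close with ℚₚ.≤-total 0ℚ p
  ... | inj₂ p≤0 = subst (ℚ._< (0ℚ ℚ.⊔ q) ℚ.+ ε) (≡-sym (ℚₚ.p≥q⇒p⊔q≡p p≤0))
        (ℚₚ.+-mono-≤-< {0ℚ} {0ℚ ℚ.⊔ q} {0ℚ} (ℚₚ.p≤p⊔q 0ℚ q) 0<ε)
  ... | inj₁ 0≤p = subst (ℚ._< (0ℚ ℚ.⊔ q) ℚ.+ ε) (≡-sym (ℚₚ.p≤q⇒p⊔q≡q 0≤p)) (begin-strict
        p                    ≡⟨ solve 2 (λ p q → p := q :+ (p :- q)) refl p q ⟩
        q ℚ.+ (p ℚ.- q)      <⟨ ℚₚ.+-monoʳ-< q (ℚₚ.≤-<-trans (p≤∣p∣ (p ℚ.- q)) close) ⟩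
        q ℚ.+ ε              ≤⟨ ℚₚ.+-monoˡ-≤ ε (ℚₚ.p≤q⊔p 0ℚ q) ⟩
        (0ℚ ℚ.⊔ q) ℚ.+ ε     ∎)
        where open ℚₚ.≤-Reasoning

  bracket-close : ∀ {p q m n lu lu′ e} → SqrtBracket p m lu → SqrtBracket q n lu′ →
                  0ℚ ℚ.< e → p ℚ.< q ℚ.+ e ℚ.* e → (1ℚ ℚ.+ q) ℚ.* halves n ℚ.< e →
                  proj₁ lu ℚ.< proj₁ lu′ ℚ.+ (e ℚ.+ e)
  bracket-close {p} {q} {m} {n} {l , u} {l′ , u′} {e} P Q 0<e p<q+e² gap<e
    with l ℚₚ.<? u′ ℚ.+ e
  ... | yes l<u′+e = begin-strict
        l                               <⟨ l<u′+e ⟩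
        u′ ℚ.+ e                        ≡⟨ solve 3 (λ l u e → u :+ e := l :+ ((u :- l) :+ e)) refl l′ u′ e ⟩
        l′ ℚ.+ ((u′ ℚ.- l′) ℚ.+ e)      <⟨ ℚₚ.+-monoʳ-< l′ (ℚₚ.+-monoˡ-< e
                                             (subst (ℚ._< e) (≡-sym (SqrtBracket.gap Q)) gap<e)) ⟩
        l′ ℚ.+ (e ℚ.+ e)                ∎
        where open ℚₚ.≤-Reasoning
  ... | no l≮u′+e = contradiction p<p (ℚₚ.<-irrefl refl)
        where
        open ℚₚ.≤-Reasoning
        u′+e≤l = ℚₚ.≮⇒≥ l≮u′+e
        0≤e = ℚₚ.<⇒≤ 0<e
        0≤u′ = ℚₚ.≤-trans (SqrtBracket.0≤l Q) (SqrtBracket.l≤u Q)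
        0≤u′+e = ℚₚ.+-mono-≤ {0ℚ} {u′} {0ℚ} 0≤u′ 0≤e
        p<p : p ℚ.< p
        p<p = begin-strict
          p                                      <⟨ p<q+e² ⟩
          q ℚ.+ e ℚ.* e                          <⟨ ℚₚ.+-monoˡ-< (e ℚ.* e) (SqrtBracket.q<u² Q) ⟩
          u′ ℚ.* u′ ℚ.+ e ℚ.* e                  ≡⟨ ≡-sym (ℚₚ.+-identityʳ _) ⟩
          (u′ ℚ.* u′ ℚ.+ e ℚ.* e) ℚ.+ 0ℚ         ≤⟨ ℚₚ.+-monoʳ-≤ (u′ ℚ.* u′ ℚ.+ e ℚ.* e)
                                                     (ℚₚ.+-mono-≤ {0ℚ} {u′ ℚ.* e} {0ℚ}
                                                       (*-nonNeg 0≤u′ 0≤e) (*-nonNeg 0≤u′ 0≤e)) ⟩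
          (u′ ℚ.* u′ ℚ.+ e ℚ.* e) ℚ.+ (u′ ℚ.* e ℚ.+ u′ ℚ.* e)
                                                 ≡⟨ solve 2 (λ u e → (u :* u :+ e :* e) :+ (u :* e :+ u :* e)
                                                      := (u :+ e) :* (u :+ e)) refl u′ e ⟩
          (u′ ℚ.+ e) ℚ.* (u′ ℚ.+ e)              ≤⟨ *-mono-≤ 0≤u′+e (SqrtBracket.0≤l P) u′+e≤l u′+e≤l ⟩
          l ℚ.* l                                ≤⟨ SqrtBracket.l²≤q P ⟩
          p                                      ∎

open BracketLemmas

√_ : ℝ → ℝ
√ x = real (√-seq (seq x)) λ ε 0<ε →
  let e       = ½ ℚ.* ε
      0<e     = half-pos 0<ε
      0<e²    = *-pos 0<e 0<e
      B , 0<B , M , ∣x∣<B = bounded x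
      N , close = cauchy x (e ℚ.* e) 0<e²
      K , small = halves→0 (1ℚ ℚ.+ B) e (ℚₚ.+-mono-< {0ℚ} {1ℚ} {0ℚ} 0<1 0<B) 0<e
      one-sided : ∀ m n → M ℕ.⊔ (N ℕ.⊔ K) ℕ.≤ m → M ℕ.⊔ (N ℕ.⊔ K) ℕ.≤ n →
                  √-seq (seq x) m ℚ.< √-seq (seq x) n ℚ.+ ε
      one-sided m n ≤m ≤n =
        let N≤m = ℕₚ.m⊔n≤o⇒m≤o N K (ℕₚ.m⊔n≤o⇒n≤o M (N ℕ.⊔ K) ≤m)
            N≤n = ℕₚ.m⊔n≤o⇒m≤o N K (ℕₚ.m⊔n≤o⇒n≤o M (N ℕ.⊔ K) ≤n)
            K≤n = ℕₚ.m⊔n≤o⇒n≤o N K (ℕₚ.m⊔n≤o⇒n≤o M (N ℕ.⊔ K) ≤n)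
            M≤n = ℕₚ.m⊔n≤o⇒m≤o M (N ℕ.⊔ K) ≤n
        in subst (λ t → √-seq (seq x) m ℚ.< √-seq (seq x) n ℚ.+ t) (half+half ε)
             (bracket-close
               (bisect-bracket _ (ℚₚ.p≤p⊔q 0ℚ (seq x m)) m)
               (bisect-bracket _ (ℚₚ.p≤p⊔q 0ℚ (seq x n)) n)
               0<e
               (⊔-close (seq x m) (seq x n) (e ℚ.* e) 0<e² (close m n N≤m N≤n))
               (ℚₚ.≤-<-trans
                 (ℚₚ.*-monoʳ-≤-nonNeg (halves n) {{ℚ.nonNegative (ℚₚ.<⇒≤ (halves-pos n))}}
                   (ℚₚ.+-monoʳ-≤ 1ℚ (ℚₚ.⊔-lub (ℚₚ.<⇒≤ 0<B)
                     (ℚₚ.≤-trans (p≤∣p∣ (seq x n)) (ℚₚ.<⇒≤ (∣x∣<B n M≤n))))))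
                 (small n K≤n)))
  in M ℕ.⊔ (N ℕ.⊔ K) , λ m n ≤m ≤n →
     ∣p∣<q (<+⇒-< (one-sided m n ≤m ≤n))
           (subst (ℚ._< ε) (solve 2 (λ a b → b :- a := :- (a :- b)) refl
                              (√-seq (seq x) m) (√-seq (seq x) n))
             (<+⇒-< (one-sided n m ≤n ≤m)))
  where
  0<1 : 0ℚ ℚ.< 1ℚ
  0<1 = *<* (ℤ.+<+ (ℕ.s≤s ℕ.z≤n))
  <+⇒-< : ∀ {a b ε} → a ℚ.< b ℚ.+ ε → a ℚ.- b ℚ.< ε
  <+⇒-< {a} {b} {ε} a<b+ε = subst (a ℚ.- b ℚ.<_)
    (solve 2 (λ b ε → (b :+ ε) :- b := ε) refl b ε) (ℚₚ.+-monoˡ-< (ℚ.- b) a<b+ε)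

Point : ℕ → Set
Point d = Vector ℝ d

infix  4 _≋_
infixl 6 _⊖_

_≋_ : ∀ {d} → Point d → Point d → Set
v ≋ w = ∀ i → v i ≈ w i

origin : ∀ {d} → Point d
origin _ = 0ℝ

_⊖_ : ∀ {d} → Point d → Point d → Point d
(v ⊖ w) i = v i - w i

‖_‖ : ∀ {d} → Point d → ℝ
‖ v ‖ = √ foldr _+_ 0ℝ (λ i → v i * v i)

-- Subsets of ℝᵈ are predicates that do not distinguish equal points.
record Subset (d : ℕ) : Set₁ where
  field
    member : Pred (Point d) 0ℓ
    resp   : member Respects _≋_

open Subset public

infix 4 _∈_

_∈_ : ∀ {d} → Point d → Subset d → Set
x ∈ X = member X x

-- dist(y, X) is the infimum of ‖y - x‖ over x ∈ X.  For empty X no real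
-- number is an infimum (the distance is +∞).
IsDist : ∀ {d} → Point d → Subset d → ℝ → Set
IsDist y X δ =
  (∀ x → x ∈ X → δ ≤ ‖ y ⊖ x ‖) ×
  (∀ b → (∀ x → x ∈ X → b ≤ ‖ y ⊖ x ‖) → b ≤ δ)

OneDense : ∀ {d} → Subset d → Set
OneDense X = ∀ y → ∃[ δ ] (IsDist y X δ × δ < 1ℝ)

{-# OPTIONS --safe #-}

-- Write c₀ for the position of p₀ predicted by walking backwards from pₙ = 0
-- with constant step -s, where before each further step the prediction cᵢ is
-- moved to a point mᵢ of the convex hull of Xᵢ ∩ B(cᵢ, 1) chosen continuously in
-- cᵢ (a partition of unity on a finite subcover).  Since |mᵢ - cᵢ| ≤ 1, the
-- map s ↦ c₀ stays within n - 1 of -n s in every coordinate, so by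
-- Poincaré–Miranda some s gives |c₀| ≤ 1.  Now choose p₁, p₂, … forwards: if
-- |pᵢ - cᵢ| ≤ 1, then mᵢ₊₁ = cᵢ + s is a convex combination of points x of Xᵢ₊₁ in
-- the unit ball around cᵢ₊₁, and the weighted mean of |x - pᵢ - s|² is
-- |mᵢ₊₁ - pᵢ - s|² plus a variance of at most 1, hence at most 2, so some x works.
--
-- The choice of s and of the points is made on rational approximations of
-- finitely many points of the Xᵢ; the strict inequality in 1-density leaves a
-- positive slack for each of them, which absorbs the errors.

module Submission where

open import Defs
open import Level using (0ℓ)
open import Axiom.ExcludedMiddle using (ExcludedMiddle)
open import Data.Nat as ℕ using (ℕ; zero; suc; NonZero)
open import Data.Fin using (Fin; zero; suc; inject₁; fromℕ)
open import Data.Product using (_×_; ∃; ∃₂; _,_; proj₁; proj₂)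
open import Data.Bool using (Bool; true; false; if_then_else_; _∧_; _xor_)
open import Data.Bool.Properties
  using (∧-zeroʳ; ∧-distribˡ-xor; ∧-distribʳ-xor; xor-assoc; xor-comm; xor-same; xor-identityʳ)
open import Data.Bool.Solver using (module xor-∧-Solver)
open import Data.Empty using (⊥; ⊥-elim)
import Data.Fin.Properties as Fin
open import Data.List using (List; []; _∷_; _++_; map; tabulate; length)
open import Data.List.Properties using (map-tabulate; length-tabulate)
open import Data.List.Relation.Unary.All as All using (All; []; _∷_)
import Data.List.Relation.Unary.All.Properties as All
open import Data.List.Relation.Unary.AllPairs using ([]; _∷_)
open import Data.List.Relation.Unary.Any using (Any; here; there)
import Data.List.Relation.Unary.Any.Properties as Any
open import Data.List.Relation.Unary.Unique.Propositional using (Unique)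
import Data.List.Relation.Unary.Unique.Propositional.Properties as Unique
import Data.Nat.Properties as ℕₚ
open import Data.Rational as ℚ using (ℚ; 0ℚ; 1ℚ; ½)
import Data.Rational.Properties as ℚₚ
open import Data.Rational.Solver using (module +-*-Solver)
open +-*-Solver using (solve; _:+_; _:*_; _:-_; :-_; _:=_; con)
open import Data.Sum using (_⊎_; inj₁; inj₂)
open import Data.Vec as Vec using (Vec; []; _∷_; lookup)
open import Data.Vec.Functional as Vector using (Vector; foldr)
open import Data.Vec.Properties using (lookup∘tabulate)
open import Function using (_∘_)
open import Relation.Binary.PropositionalEquality
open import Relation.Nullary using (¬_; Dec; contradiction; yes; no; does)
open import Relation.Nullary.Decidable using (dec-true; dec-false)

open RationalLemmas hiding (fromℕ)
open BoundLemmas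
open BracketLemmas
private module R = RationalLemmas

-- A prediction within distance 1 of the origin suffices, because the averaging step tolerates any
-- point of the unit ball around its prediction. No exact zero of the prediction map is sought, so a
-- finite Poincaré-Miranda theorem on a fine grid does the job, with Lipschitz constants in place of
-- a limit. It is a parity count: for the sign functions `a k` of the coordinates, the cup product
-- of their coboundaries over 𝔽₂ sums to 1 over all cubes of the grid, so on some cube every sign
-- changes.
--
-- The search runs over rationals because their signs and squared distances are decidable, unlike
-- those of Cauchy reals. Excluded middle enters when a member of a set is extracted from an open
-- ball and in the bisection for finite covers.
--
-- The mean and its variance appear without explicit weights: for fixed `z` and `c`, the difference
-- of the squared distances of `x` to `z` and to `c` is affine in `x`, so its value at a convex
-- combination is at least its value at one of the combined points.

private variable
  A : Set
  d n : ℕ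
  p q r R ε : ℚ

-- Poincaré–Miranda modulo 2

-- The xor of f k Q over all ways of picking k out of a list, Q being the rest.
picks : (A → List A → Bool) → List A → Bool
picks f []      = false
picks f (k ∷ R) = f k R xor picks (λ l Q → f l (k ∷ Q)) R

picks-cong : ∀ {f g : A → List A → Bool} → (∀ k Q → f k Q ≡ g k Q) →
             ∀ R → picks f R ≡ picks g R
picks-cong f≗g []      = refl
picks-cong f≗g (k ∷ R) = cong₂ _xor_ (f≗g k R) (picks-cong (λ l Q → f≗g l (k ∷ Q)) R)

xor-exchange : ∀ a b c e → (a xor b) xor (c xor e) ≡ (a xor c) xor (b xor e)
xor-exchange = xor-∧-Solver.solve 4 (λ a b c e →
  (a :⊕ b) :⊕ (c :⊕ e) xor-∧-Solver.:= (a :⊕ c) :⊕ (b :⊕ e)) refl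
  where _:⊕_ = xor-∧-Solver._:+_

picks-xor : ∀ (f g : A → List A → Bool) R →
            picks (λ k Q → f k Q xor g k Q) R ≡ picks f R xor picks g R
picks-xor f g []      = refl
picks-xor f g (k ∷ R) = trans
  (cong ((f k R xor g k R) xor_) (picks-xor (λ l Q → f l (k ∷ Q)) (λ l Q → g l (k ∷ Q)) R))
  (xor-exchange (f k R) (g k R) _ _)

picks-∧ : ∀ b (f : A → List A → Bool) R → picks (λ k Q → b ∧ f k Q) R ≡ b ∧ picks f R
picks-∧ b f []      = sym (∧-zeroʳ b)
picks-∧ b f (k ∷ R) = trans (cong ((b ∧ f k R) xor_) (picks-∧ b (λ l Q → f l (k ∷ Q)) R))
  (sym (∧-distribˡ-xor b (f k R) _))

xor-cancelˡ : ∀ a b → a xor (a xor b) ≡ b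
xor-cancelˡ a b = trans (sym (xor-assoc a a b)) (cong (_xor b) (xor-same a))

xor≡false : ∀ {a b} → a xor b ≡ false → a ≡ b
xor≡false {a} {b} e = trans (sym (xor-identityʳ a)) (trans (cong (a xor_) (sym e)) (xor-cancelˡ a b))

-- Ordered pairs of picks cancel in twos.
picks-sym : ∀ (f : A → A → List A → Bool) → (∀ k l Q → f k l Q ≡ f l k Q) →
            ∀ R → picks (λ k → picks (f k)) R ≡ false
picks-sym f f-sym []      = refl
picks-sym f f-sym (m ∷ R) = begin
  picks (f m) R xor picks (λ k Q → f k m Q xor picks (λ l P → f k l (m ∷ P)) Q) R
    ≡⟨ cong (picks (f m) R xor_) (picks-xor (λ k → f k m) _ R) ⟩
  picks (f m) R xor (picks (λ k → f k m) R xor picks (λ k → picks (λ l P → f k l (m ∷ P))) R)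
    ≡⟨ cong₂ (λ p q → picks (f m) R xor (p xor q)) (picks-cong (λ k Q → f-sym k m Q) R)
         (picks-sym (λ k l P → f k l (m ∷ P)) (λ k l P → f-sym k l (m ∷ P)) R) ⟩
  picks (f m) R xor (picks (f m) R xor false)
    ≡⟨ xor-cancelˡ (picks (f m) R) false ⟩
  false ∎
  where open ≡-Reasoning

-- The xor of the two sides is a double sum of `f k l Q xor f l k Q`, which is symmetric in the two
-- picks.
picks-swap : ∀ (f : A → A → List A → Bool) R →
             picks (λ k → picks (f k)) R ≡ picks (λ k → picks (λ l → f l k)) R
picks-swap f R = xor≡false (begin
  picks (λ k → picks (f k)) R xor picks (λ k → picks (λ l → f l k)) R
    ≡⟨ sym (picks-xor (λ k → picks (f k)) (λ k → picks (λ l → f l k)) R) ⟩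
  picks (λ k Q → picks (f k) Q xor picks (λ l → f l k) Q) R
    ≡⟨ picks-cong (λ k Q → sym (picks-xor (f k) (λ l → f l k) Q)) R ⟩
  picks (λ k → picks (λ l Q → f k l Q xor f l k Q)) R
    ≡⟨ picks-sym _ (λ k l Q → xor-comm (f k l Q) (f l k Q)) R ⟩
  false ∎)
  where open ≡-Reasoning

picks-map : ∀ {A B : Set} (f : B → List B → Bool) (g : A → B) R →
            picks f (map g R) ≡ picks (λ k Q → f (g k) (map g Q)) R
picks-map f g []      = refl
picks-map f g (k ∷ R) = cong (f (g k) (map g R) xor_) (picks-map (λ l Q → f l (g k ∷ Q)) g R)

-- The index set of the sum `picks f R`, as a relation, so that summands can be shown to vanish from
-- properties of `k` and `Q`.
data Pick {A : Set} : List A → A → List A → Set where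
  here  : ∀ {k R} → Pick (k ∷ R) k R
  there : ∀ {k l Q R} → Pick R l Q → Pick (k ∷ R) l (k ∷ Q)

Pick⁺ : ∀ {P : A → Set} {R k Q} → All P R → Pick R k Q → P k × All P Q
Pick⁺ (p ∷ ps) here      = p , ps
Pick⁺ (p ∷ ps) (there c) = let q , qs = Pick⁺ ps c in q , p ∷ qs

Pick-unique : ∀ {R k Q} → Unique {A = A} R → Pick R k Q → All (k ≢_) Q
Pick-unique (k∉R ∷ R!) here      = k∉R
Pick-unique (m∉R ∷ R!) (there c) = (proj₁ (Pick⁺ m∉R c) ∘ sym) ∷ Pick-unique R! c

picks-false : ∀ (f : A → List A → Bool) R → (∀ {k Q} → Pick R k Q → f k Q ≡ false) →
              picks f R ≡ false
picks-false f []      f≡false = refl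
picks-false f (k ∷ R) f≡false =
  cong₂ _xor_ (f≡false here) (picks-false (λ l Q → f l (k ∷ Q)) R (f≡false ∘ there))

picks-true : ∀ (f : A → List A → Bool) R → picks f R ≡ true → ∃₂ λ k Q → f k Q ≡ true
picks-true f (k ∷ R) e with f k R in eq
... | true  = k , R , eq
... | false = let l , Q , e′ = picks-true (λ l Q → f l (k ∷ Q)) R e in l , k ∷ Q , e′

-- Coboundaries and cup products on the cubical grid

bump : Fin d → Vec ℕ d → Vec ℕ d
bump zero    (i ∷ x) = suc i ∷ x
bump (suc k) (i ∷ x) = i ∷ bump k x

bump-comm : ∀ (k l : Fin d) x → bump k (bump l x) ≡ bump l (bump k x)
bump-comm zero    zero    (i ∷ x) = refl
bump-comm zero    (suc l) (i ∷ x) = refl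
bump-comm (suc k) zero    (i ∷ x) = refl
bump-comm (suc k) (suc l) (i ∷ x) = cong (i ∷_) (bump-comm k l x)

lookup-bump : ∀ (k l : Fin d) x → k ≢ l → lookup (bump l x) k ≡ lookup x k
lookup-bump zero    zero    (i ∷ x) k≢l = contradiction refl k≢l
lookup-bump zero    (suc l) (i ∷ x) k≢l = refl
lookup-bump (suc k) zero    (i ∷ x) k≢l = refl
lookup-bump (suc k) (suc l) (i ∷ x) k≢l = lookup-bump k l x (k≢l ∘ cong suc)

-- The value of the cochain δa₁ ∪ … ∪ δaₘ over 𝔽₂ on the cube at x spanned by the
-- directions R: a sum over the monotone edge paths from x to the opposite corner.
cup : Vec ℕ d → List (Fin d) → List (Vec ℕ d → Bool) → Bool
cup x R []       = true
cup x R (a ∷ as) = picks (λ k Q → (a (bump k x) xor a x) ∧ cup (bump k x) Q as) R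

-- δ(δa₁ ∪ … ∪ δaₘ) = 0.
cup-closed : ∀ as R (x : Vec ℕ d) →
             picks (λ k Q → cup (bump k x) Q as) R ≡ picks (λ k Q → cup x Q as) R
cup-closed []       R x = refl
cup-closed (b ∷ bs) R x = begin
  picks (λ k → picks (λ l Q → (b (bump l (bump k x)) xor b (bump k x)) ∧ U k l Q)) R
    ≡⟨ picks-cong (λ k → expand (bump k x)) R ⟩
  picks (λ k Q → picks (F k) Q xor G k Q) R
    ≡⟨ picks-xor (λ k → picks (F k)) G R ⟩
  picks (λ k → picks (F k)) R xor picks G R
    -- Bumps commute, so `F` is symmetric in the two directions and its double sum vanishes.
    ≡⟨ cong (_xor picks G R)
         (picks-sym F (λ k l Q → cong (λ y → b y ∧ cup y Q bs) (bump-comm l k x)) R) ⟩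
  picks G R
    ≡⟨ picks-cong (λ k Q → trans (cong (b (bump k x) ∧_) (cup-closed bs Q (bump k x)))
         (sym (picks-∧ (b (bump k x)) (λ l P → cup (bump k x) P bs) Q))) R ⟩
  picks (λ k → picks (λ l → H k)) R
    ≡⟨ picks-swap (λ k l → H k) R ⟩
  picks (λ k → picks H) R
    ≡⟨ xor-identityʳ (picks (λ k → picks H) R) ⟨
  picks (λ k → picks H) R xor false
    ≡⟨ cong (picks (λ k → picks H) R xor_) base ⟨
  picks (λ k → picks H) R xor picks (λ k Q → b x ∧ picks (λ l P → cup (bump l x) P bs) Q) R
    ≡⟨ picks-xor (λ k → picks H) (λ k Q → b x ∧ picks (λ l P → cup (bump l x) P bs) Q) R ⟨
  picks (λ k Q → picks H Q xor b x ∧ picks (λ l P → cup (bump l x) P bs) Q) R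
    ≡⟨ picks-cong (λ k → expand x) R ⟨
  picks (λ k → picks (λ l Q → (b (bump l x) xor b x) ∧ cup (bump l x) Q bs)) R ∎
  where
  open ≡-Reasoning
  U   = λ k l Q → cup (bump l (bump k x)) Q bs
  F   = λ k l Q → b (bump l (bump k x)) ∧ U k l Q
  G   = λ k Q → b (bump k x) ∧ picks (U k) Q
  H   = λ k Q → b (bump k x) ∧ cup (bump k x) Q bs
  expand : ∀ y Q → picks (λ l P → (b (bump l y) xor b y) ∧ cup (bump l y) P bs) Q
                 ≡ picks (λ l P → b (bump l y) ∧ cup (bump l y) P bs) Q
                   xor b y ∧ picks (λ l P → cup (bump l y) P bs) Q
  expand y Q = trans
    (picks-cong (λ l P → ∧-distribʳ-xor (cup (bump l y) P bs) (b (bump l y)) (b y)) Q)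
    (trans (picks-xor (λ l P → b (bump l y) ∧ V l P) (λ l P → b y ∧ V l P) Q)
      (cong (picks (λ l P → b (bump l y) ∧ V l P) Q xor_) (picks-∧ (b y) V Q)))
    where V = λ l P → cup (bump l y) P bs
  -- By induction the corner `bump l x` may be moved back to `x`; the summand then no longer depends
  -- on which two directions were picked in which order.
  base : picks (λ k Q → b x ∧ picks (λ l P → cup (bump l x) P bs) Q) R ≡ false
  base = begin
    picks (λ k Q → b x ∧ picks (λ l P → cup (bump l x) P bs) Q) R
      ≡⟨ picks-∧ (b x) (λ k → picks (λ l P → cup (bump l x) P bs)) R ⟩
    b x ∧ picks (λ k → picks (λ l P → cup (bump l x) P bs)) R
      ≡⟨ cong (b x ∧_) (picks-cong (λ k Q → cup-closed bs Q x) R) ⟩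
    b x ∧ picks (λ k → picks (λ l P → cup x P bs)) R
      ≡⟨ cong (b x ∧_) (picks-sym (λ k l P → cup x P bs) (λ _ _ _ → refl) R) ⟩
    b x ∧ false
      ≡⟨ ∧-zeroʳ (b x) ⟩
    false ∎

-- With ω the product of the coboundaries of `as`, closedness of ω turns δa ∪ ω into the coboundary
-- of a ∪ ω, a sum over pairs of opposite facets of the cube.
cup-stokes : ∀ a as R (x : Vec ℕ d) →
             cup x R (a ∷ as) ≡ picks (λ k Q → a (bump k x) ∧ cup (bump k x) Q as xor a x ∧ cup x Q as) R
cup-stokes a as R x = begin
  picks (λ k Q → (a (bump k x) xor a x) ∧ U k Q) R
    ≡⟨ picks-cong (λ k Q → ∧-distribʳ-xor (U k Q) (a (bump k x)) (a x)) R ⟩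
  picks (λ k Q → F k Q xor a x ∧ U k Q) R
    ≡⟨ picks-xor F (λ k Q → a x ∧ U k Q) R ⟩
  picks F R xor picks (λ k Q → a x ∧ U k Q) R
    ≡⟨ cong (picks F R xor_) (trans (picks-∧ (a x) U R)
         (trans (cong (a x ∧_) (cup-closed as R x)) (sym (picks-∧ (a x) (λ k Q → cup x Q as) R)))) ⟩
  picks F R xor picks (λ k Q → a x ∧ cup x Q as) R
    ≡⟨ picks-xor F (λ k Q → a x ∧ cup x Q as) R ⟨
  picks (λ k Q → F k Q xor a x ∧ cup x Q as) R ∎
  where
  open ≡-Reasoning
  U = λ k Q → cup (bump k x) Q as
  F = λ k Q → a (bump k x) ∧ U k Q

-- A cube without an edge in direction `k` stays in the hyperplane where coordinate `k` is `v`. Some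
-- factor is constant there, so its coboundary is zero on every edge of every path.
cup-vanishes : ∀ {k : Fin d} {v b} as R x → Any (λ a → ∀ y → lookup y k ≡ v → a y ≡ b) as →
               lookup x k ≡ v → All (k ≢_) R → cup x R as ≡ false
cup-vanishes {k = k} {v} {b} (a ∷ as) R x a-const xₖ≡v k∉R = picks-false _ R step
  where
  step : ∀ {l Q} → Pick R l Q → (a (bump l x) xor a x) ∧ cup (bump l x) Q as ≡ false
  step {l} {Q} pick with Pick⁺ k∉R pick
  ... | k≢l , k∉Q = go a-const
    where
    x′ₖ≡v = trans (lookup-bump k l x k≢l) xₖ≡v
    go : Any _ (a ∷ as) → _
    go (here const) = cong (_∧ cup (bump l x) Q as)
      (trans (cong₂ _xor_ (const _ x′ₖ≡v) (const _ xₖ≡v)) (xor-same b))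
    go (there p) = trans (cong ((a (bump l x) xor a x) ∧_) (cup-vanishes as Q (bump l x) p x′ₖ≡v k∉Q)) (∧-zeroʳ (a (bump l x) xor a x))

cup-face : ∀ i (x : Vec ℕ d) R as →
           cup (i ∷ x) (map suc R) as ≡ cup x R (map (_∘ (i ∷_)) as)
cup-face i x R []       = refl
cup-face i x R (a ∷ as) = trans (picks-map _ suc R)
  (picks-cong (λ k Q → cong (_ ∧_) (cup-face i (bump k x) Q as)) R)

-- Parity sums over the grid

⨁ : ℕ → (ℕ → Bool) → Bool
⨁ zero    f = false
⨁ (suc M) f = f M xor ⨁ M f

⨁-cong : ∀ {f g} M → (∀ i → f i ≡ g i) → ⨁ M f ≡ ⨁ M g
⨁-cong zero    f≗g = refl
⨁-cong (suc M) f≗g = cong₂ _xor_ (f≗g M) (⨁-cong M f≗g)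

⨁-xor : ∀ M f g → ⨁ M (λ i → f i xor g i) ≡ ⨁ M f xor ⨁ M g
⨁-xor zero    f g = refl
⨁-xor (suc M) f g = trans (cong ((f M xor g M) xor_) (⨁-xor M f g)) (xor-exchange (f M) (g M) _ _)

⨁-false : ∀ M {f} → (∀ i → f i ≡ false) → ⨁ M f ≡ false
⨁-false zero    f≡false = refl
⨁-false (suc M) f≡false = cong₂ _xor_ (f≡false M) (⨁-false M f≡false)

⨁-telescope : ∀ M (f : ℕ → Bool) → ⨁ M (λ i → f (suc i) xor f i) ≡ f M xor f 0
⨁-telescope zero    f = sym (xor-same (f 0))
⨁-telescope (suc M) f = trans (cong ((f (suc M) xor f M) xor_) (⨁-telescope M f))
  (trans (xor-assoc (f (suc M)) (f M) (f M xor f 0)) (cong (f (suc M) xor_) (xor-cancelˡ (f M) (f 0))))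

⨁-true : ∀ M f → ⨁ M f ≡ true → ∃ λ i → f i ≡ true
⨁-true (suc M) f e with f M in eq
... | true  = M , eq
... | false = ⨁-true M f e

module _ (M : ℕ) where

  -- The index runs over lower corners of cubes, so coordinates stay below `M`; the vertices with
  -- coordinate `M` are reached only by bumping.
  ⨁ᵈ : (Vec ℕ d → Bool) → Bool
  ⨁ᵈ {zero}  f = f []
  ⨁ᵈ {suc d} f = ⨁ M (λ i → ⨁ᵈ (f ∘ (i ∷_)))

  ⨁ᵈ-cong : ∀ {f g : Vec ℕ d → Bool} → (∀ x → f x ≡ g x) → ⨁ᵈ f ≡ ⨁ᵈ g
  ⨁ᵈ-cong {zero}  f≗g = f≗g []
  ⨁ᵈ-cong {suc d} f≗g = ⨁-cong M (λ i → ⨁ᵈ-cong (f≗g ∘ (i ∷_)))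

  ⨁ᵈ-xor : ∀ (f g : Vec ℕ d → Bool) → ⨁ᵈ (λ x → f x xor g x) ≡ ⨁ᵈ f xor ⨁ᵈ g
  ⨁ᵈ-xor {zero}  f g = refl
  ⨁ᵈ-xor {suc d} f g = trans (⨁-cong M (λ i → ⨁ᵈ-xor (f ∘ (i ∷_)) (g ∘ (i ∷_)))) (⨁-xor M _ _)

  ⨁ᵈ-false : ∀ {f : Vec ℕ d → Bool} → (∀ x → f x ≡ false) → ⨁ᵈ f ≡ false
  ⨁ᵈ-false {zero}  f≡false = f≡false []
  ⨁ᵈ-false {suc d} f≡false = ⨁-false M (λ i → ⨁ᵈ-false (f≡false ∘ (i ∷_)))

  ⨁ᵈ-true : ∀ (f : Vec ℕ d → Bool) → ⨁ᵈ f ≡ true → ∃ λ x → f x ≡ true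
  ⨁ᵈ-true {zero}  f e = [] , e
  ⨁ᵈ-true {suc d} f e =
    let i , eᵢ = ⨁-true M _ e ; x , eₓ = ⨁ᵈ-true (f ∘ (i ∷_)) eᵢ in i ∷ x , eₓ

  ⨁ᵈ-picks : ∀ (f : Vec ℕ d → A → List A → Bool) R →
             ⨁ᵈ (λ x → picks (f x) R) ≡ picks (λ k Q → ⨁ᵈ (λ x → f x k Q)) R
  ⨁ᵈ-picks f []      = ⨁ᵈ-false {f = λ x → picks (f x) []} (λ _ → refl)
  ⨁ᵈ-picks f (k ∷ R) = trans (⨁ᵈ-xor (λ x → f x k R) (λ x → picks (λ l Q → f x l (k ∷ Q)) R))
    (cong (⨁ᵈ (λ x → f x k R) xor_) (⨁ᵈ-picks (λ x l Q → f x l (k ∷ Q)) R))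

  -- Facets orthogonal to `k` inside the grid are counted twice and cancel; only the two outer
  -- layers remain.
  ⨁ᵈ-telescope : ∀ (k : Fin d) (f : Vec ℕ d → Bool) →
                 (∀ x → lookup x k ≡ 0 → f x ≡ false) → (∀ x → lookup x k ≡ M → f x ≡ false) →
                 ⨁ᵈ (λ x → f (bump k x) xor f x) ≡ false
  ⨁ᵈ-telescope zero f f₀ f₁ = begin
    ⨁ M (λ i → ⨁ᵈ (λ x → f (suc i ∷ x) xor f (i ∷ x)))
      ≡⟨ ⨁-cong M (λ i → ⨁ᵈ-xor (f ∘ (suc i ∷_)) (f ∘ (i ∷_))) ⟩
    ⨁ M (λ i → ⨁ᵈ (f ∘ (suc i ∷_)) xor ⨁ᵈ (f ∘ (i ∷_)))
      ≡⟨ ⨁-telescope M (λ i → ⨁ᵈ (f ∘ (i ∷_))) ⟩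
    ⨁ᵈ (f ∘ (M ∷_)) xor ⨁ᵈ (f ∘ (0 ∷_))
      ≡⟨ cong₂ _xor_ (⨁ᵈ-false (λ x → f₁ (M ∷ x) refl)) (⨁ᵈ-false (λ x → f₀ (0 ∷ x) refl)) ⟩
    false ∎
    where open ≡-Reasoning
  ⨁ᵈ-telescope (suc k) f f₀ f₁ =
    ⨁-false M (λ i → ⨁ᵈ-telescope k (f ∘ (i ∷_)) (f₀ ∘ (i ∷_)) (f₁ ∘ (i ∷_)))

directions : ∀ d → List (Fin d)
directions zero    = []
directions (suc d) = zero ∷ map suc (directions d)

directions-unique : ∀ d → Unique (directions d)
directions-unique zero    = []
directions-unique (suc d) = All.map⁺ (All.universal (λ _ ()) _)
  ∷ Unique.map⁺ Fin.suc-injective (directions-unique d)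

module _ {M : ℕ} where

  -- Induction on the dimension. By `cup-stokes` the total becomes a sum over the outer facets of
  -- the grid. On those orthogonal to a direction `suc k` the factor `a (suc k)` is constant, so
  -- they contribute nothing. Of the remaining two, `a zero` kills the one at 0 and is true on the
  -- one at `M`, which leaves the total of the other functions in one dimension less.
  total≡true : (a : Fin d → Vec ℕ d → Bool) →
               (∀ k x → lookup x k ≡ 0 → a k x ≡ false) →
               (∀ k x → lookup x k ≡ M → a k x ≡ true) →
               ⨁ᵈ M (λ x → cup x (directions d) (tabulate a)) ≡ true
  total≡true {zero}  a a₀ a₁ = refl
  total≡true {suc d} a a₀ a₁ = begin
    ⨁ᵈ M (λ x → cup x (zero ∷ D) (a₀′ ∷ as))
      ≡⟨ ⨁ᵈ-cong M (cup-stokes a₀′ as (zero ∷ D)) ⟩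
    ⨁ᵈ M (λ x → picks (λ k Q → h Q (bump k x) xor h Q x) (zero ∷ D))
      ≡⟨ ⨁ᵈ-picks M (λ x k Q → h Q (bump k x) xor h Q x) (zero ∷ D) ⟩
    ⨁ᵈ M (λ x → h D (bump zero x) xor h D x)
      xor picks (λ k Q → ⨁ᵈ M (λ x → h (zero ∷ Q) (bump k x) xor h (zero ∷ Q) x)) D
      ≡⟨ cong (⨁ᵈ M (λ x → h D (bump zero x) xor h D x) xor_) (picks-false _ D side) ⟩
    ⨁ᵈ M (λ x → h D (bump zero x) xor h D x) xor false
      ≡⟨ xor-identityʳ _ ⟩
    ⨁ M (λ i → ⨁ᵈ M (λ x → h D (suc i ∷ x) xor h D (i ∷ x)))
      ≡⟨ ⨁-cong M (λ i → ⨁ᵈ-xor M (h D ∘ (suc i ∷_)) (h D ∘ (i ∷_))) ⟩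
    ⨁ M (λ i → ⨁ᵈ M (h D ∘ (suc i ∷_)) xor ⨁ᵈ M (h D ∘ (i ∷_)))
      ≡⟨ ⨁-telescope M (λ i → ⨁ᵈ M (h D ∘ (i ∷_))) ⟩
    ⨁ᵈ M (h D ∘ (M ∷_)) xor ⨁ᵈ M (h D ∘ (0 ∷_))
      ≡⟨ cong₂ _xor_ (⨁ᵈ-cong M top) (⨁ᵈ-false M (λ x → cong (_∧ cup (0 ∷ x) D as) (a₀ zero (0 ∷ x) refl))) ⟩
    ⨁ᵈ M (λ x → cup x (directions d) (tabulate a′)) xor false
      ≡⟨ xor-identityʳ _ ⟩
    ⨁ᵈ M (λ x → cup x (directions d) (tabulate a′))
      ≡⟨ total≡true a′ (λ k x → a₀ (suc k) (M ∷ x)) (λ k x → a₁ (suc k) (M ∷ x)) ⟩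
    true ∎
    where
    open ≡-Reasoning
    D = map suc (directions d)
    a₀′ = a zero
    as = tabulate (a ∘ suc)
    a′ : Fin d → Vec ℕ d → Bool
    a′ k x = a (suc k) (M ∷ x)
    h : List (Fin (suc d)) → Vec ℕ (suc d) → Bool
    h Q x = a₀′ x ∧ cup x Q as
    top : ∀ x → h D (M ∷ x) ≡ cup x (directions d) (tabulate a′)
    top x = begin
      a₀′ (M ∷ x) ∧ cup (M ∷ x) D as      ≡⟨ cong (_∧ cup (M ∷ x) D as) (a₁ zero (M ∷ x) refl) ⟩
      cup (M ∷ x) D as                    ≡⟨ cup-face M x (directions d) as ⟩
      cup x (directions d) (map (_∘ (M ∷_)) as)
        ≡⟨ cong (cup x (directions d)) (map-tabulate (a ∘ suc) (_∘ (M ∷_))) ⟩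
      cup x (directions d) (tabulate a′)  ∎
    side : ∀ {k Q} → Pick D k Q → ⨁ᵈ M (λ x → h (zero ∷ Q) (bump k x) xor h (zero ∷ Q) x) ≡ false
    side {zero} pick = contradiction refl
      (proj₁ (Pick⁺ {P = zero ≢_} (All.map⁺ (All.universal (λ _ ()) _)) pick))
    side {suc k} {Q} pick = ⨁ᵈ-telescope M (suc k) (h (zero ∷ Q))
      (λ x e → trans (cong (a₀′ x ∧_) (cup-vanishes as (zero ∷ Q) x
         (Any.tabulate⁺ k (λ y → a₀ (suc k) y)) e ((λ ()) ∷ k∉Q))) (∧-zeroʳ (a₀′ x)))
      (λ x e → trans (cong (a₀′ x ∧_) (cup-vanishes as (zero ∷ Q) x
         (Any.tabulate⁺ k (λ y → a₁ (suc k) y)) e ((λ ()) ∷ k∉Q))) (∧-zeroʳ (a₀′ x)))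
      where
      k∉Q = Pick-unique (Unique.map⁺ Fin.suc-injective (directions-unique d)) pick

-- From an odd total to a cell where every function changes

infix 4 _≼[_]_

-- The vertices of the unit cube at `x` satisfy this already with `m = 1`. Counting the bumps along
-- a path is a coarser bound that needs no bookkeeping of directions; the resulting factor `d` is
-- absorbed by the mesh.
_≼[_]_ : Vec ℕ d → ℕ → Vec ℕ d → Set
x ≼[ m ] y = ∀ k → lookup x k ℕ.≤ lookup y k × lookup y k ℕ.≤ m ℕ.+ lookup x k

≼-refl : ∀ {x : Vec ℕ d} {m} → x ≼[ m ] x
≼-refl {m = m} k = ℕₚ.≤-refl , ℕₚ.m≤n+m _ m

bump-≼ : ∀ (l : Fin d) x k → lookup x k ℕ.≤ lookup (bump l x) k × lookup (bump l x) k ℕ.≤ suc (lookup x k)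
bump-≼ zero    (i ∷ x) zero    = ℕₚ.n≤1+n i , ℕₚ.≤-refl
bump-≼ zero    (i ∷ x) (suc k) = ℕₚ.≤-refl , ℕₚ.n≤1+n _
bump-≼ (suc l) (i ∷ x) zero    = ℕₚ.≤-refl , ℕₚ.n≤1+n i
bump-≼ (suc l) (i ∷ x) (suc k) = bump-≼ l x k

≼-bump : ∀ (l : Fin d) {x m y} → bump l x ≼[ m ] y → x ≼[ suc m ] y
≼-bump l {x} {m} {y} x≼y k =
  ℕₚ.≤-trans (proj₁ (bump-≼ l x k)) (proj₁ (x≼y k)) ,
  ℕₚ.≤-trans (proj₂ (x≼y k)) (subst (m ℕ.+ lookup (bump l x) k ℕ.≤_) (ℕₚ.+-suc m (lookup x k))
    (ℕₚ.+-monoʳ-≤ m (proj₂ (bump-≼ l x k))))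

∧-true : ∀ {a b} → a ∧ b ≡ true → a ≡ true × b ≡ true
∧-true {true} e = refl , e

Changes : Vec ℕ d → ℕ → (Vec ℕ d → Bool) → Set
Changes x m a = ∃₂ λ y z → x ≼[ m ] y × x ≼[ m ] z × a y ≡ true × a z ≡ false

xor-true : ∀ {a b} → a xor b ≡ true → (a ≡ true × b ≡ false) ⊎ (a ≡ false × b ≡ true)
xor-true {true}  {false} e = inj₁ (refl , refl)
xor-true {false} {true}  e = inj₂ (refl , refl)

-- An odd number of paths contribute, so at least one does, and along it each function changes on
-- its own edge. The number of factors is the length of that path.
cup-changes : ∀ as R (x : Vec ℕ d) → cup x R as ≡ true → All (Changes x (length as)) as
cup-changes []       R x e = []
cup-changes (a ∷ as) R x e with picks-true (λ k Q → (a (bump k x) xor a x) ∧ cup (bump k x) Q as) R e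
... | k , Q , e′ with ∧-true {a (bump k x) xor a x} e′
... | e₁ , e₂ = now (xor-true e₁) ∷ All.map later (cup-changes as Q (bump k x) e₂)
  where
  later : ∀ {b m} → Changes (bump k x) m b → Changes x (suc m) b
  later (y , z , x≼y , x≼z , by , bz) =
    y , z , ≼-bump k {x} {y = y} x≼y , ≼-bump k {x} {y = z} x≼z , by , bz
  now : ∀ {m} → (a (bump k x) ≡ true × a x ≡ false) ⊎ (a (bump k x) ≡ false × a x ≡ true) →
        Changes x (suc m) a
  now (inj₁ (e₁ , e₀)) = bump k x , x , ≼-bump k {x} {y = bump k x} (≼-refl {x = bump k x}) , ≼-refl {x = x} , e₁ , e₀
  now (inj₂ (e₁ , e₀)) = x , bump k x , ≼-refl {x = x} , ≼-bump k {x} {y = bump k x} (≼-refl {x = bump k x}) , e₀ , e₁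

poincaré-miranda : ∀ M (a : Fin d → Vec ℕ d → Bool) →
                   (∀ k x → lookup x k ≡ 0 → a k x ≡ false) →
                   (∀ k x → lookup x k ≡ M → a k x ≡ true) →
                   ∃ λ x → ∀ k → Changes x d (a k)
poincaré-miranda {d} M a a₀ a₁ with ⨁ᵈ-true M _ (total≡true a a₀ a₁)
... | x , e = x , λ k → subst (λ m → Changes x m (a k)) (length-tabulate a)
  (All.tabulate⁻ (cup-changes (tabulate a) (directions d) x e) k)

-- Rational vectors

-- Inequalities between polynomials are proved by exhibiting q - p as a
-- nonnegative expression r and leaving the identity p + r ≡ q to the ring solver.
≤-cert : 0ℚ ℚ.≤ r → p ℚ.+ r ≡ q → p ℚ.≤ q
≤-cert {r} {p} 0≤r refl = subst (ℚ._≤ p ℚ.+ r) (ℚₚ.+-identityʳ p) (ℚₚ.+-monoʳ-≤ p 0≤r)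

0≤q-p : p ℚ.≤ q → 0ℚ ℚ.≤ q ℚ.- p
0≤q-p {p} {q} p≤q = subst (ℚ._≤ q ℚ.- p) (ℚₚ.+-inverseʳ p) (ℚₚ.+-monoˡ-≤ (ℚ.- p) p≤q)

+-nonNeg : 0ℚ ℚ.≤ p → 0ℚ ℚ.≤ q → 0ℚ ℚ.≤ p ℚ.+ q
+-nonNeg {p} {q} 0≤p 0≤q = ℚₚ.+-mono-≤ {0ℚ} {p} {0ℚ} 0≤p 0≤q

square-nonNeg : ∀ p → 0ℚ ℚ.≤ p ℚ.* p
square-nonNeg p with ℚₚ.≤-total 0ℚ p
... | inj₁ 0≤p = *-nonNeg 0≤p 0≤p
... | inj₂ p≤0 = subst (0ℚ ℚ.≤_) (solve 1 (λ p → (:- p) :* (:- p) := p :* p) refl p)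
                   (*-nonNeg (ℚₚ.neg-antimono-≤ p≤0) (ℚₚ.neg-antimono-≤ p≤0))

∣p∣≤q : p ℚ.≤ q → ℚ.- p ℚ.≤ q → ℚ.∣ p ∣ ℚ.≤ q
∣p∣≤q {p} {q} p≤q -p≤q with ℚₚ.∣p∣≡p∨∣p∣≡-p p
... | inj₁ e = subst (ℚ._≤ q) (sym e) p≤q
... | inj₂ e = subst (ℚ._≤ q) (sym e) -p≤q

∣p∣≤⇒p≤ : ℚ.∣ p ∣ ℚ.≤ q → p ℚ.≤ q
∣p∣≤⇒p≤ {p} = ℚₚ.≤-trans (p≤∣p∣ p)

∣p∣≤⇒-p≤ : ℚ.∣ p ∣ ℚ.≤ q → ℚ.- p ℚ.≤ q
∣p∣≤⇒-p≤ {p} {q} le = ∣p∣≤⇒p≤ (subst (ℚ._≤ q) (sym (ℚₚ.∣-p∣≡∣p∣ p)) le)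

∣p∣*∣p∣ : ∀ p → ℚ.∣ p ∣ ℚ.* ℚ.∣ p ∣ ≡ p ℚ.* p
∣p∣*∣p∣ p with ℚₚ.∣p∣≡p∨∣p∣≡-p p
... | inj₁ e = cong₂ ℚ._*_ e e
... | inj₂ e = trans (cong₂ ℚ._*_ e e) (solve 1 (λ p → (:- p) :* (:- p) := p :* p) refl p)

∣∣-triangle : ∀ p q r → ℚ.∣ p ℚ.- r ∣ ℚ.≤ ℚ.∣ p ℚ.- q ∣ ℚ.+ ℚ.∣ q ℚ.- r ∣
∣∣-triangle p q r = subst (λ t → ℚ.∣ t ∣ ℚ.≤ ℚ.∣ p ℚ.- q ∣ ℚ.+ ℚ.∣ q ℚ.- r ∣)
  (solve 3 (λ p q r → (p :- q) :+ (q :- r) := p :- r) refl p q r)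
  (ℚₚ.∣p+q∣≤∣p∣+∣q∣ (p ℚ.- q) (q ℚ.- r))

∣p*q∣≤ : ∀ {p q P Q} → ℚ.∣ p ∣ ℚ.≤ P → ℚ.∣ q ∣ ℚ.≤ Q → ℚ.∣ p ℚ.* q ∣ ℚ.≤ P ℚ.* Q
∣p*q∣≤ {p} {q} {P} {Q} p≤P q≤Q = subst (ℚ._≤ P ℚ.* Q) (sym (ℚₚ.∣p*q∣≡∣p∣*∣q∣ p q))
  (*-mono-≤ (ℚₚ.0≤∣p∣ p) (ℚₚ.≤-trans (ℚₚ.0≤∣p∣ q) q≤Q) p≤P q≤Q)

p²≤1⇒∣p∣≤1 : ∀ p → p ℚ.* p ℚ.≤ 1ℚ → ℚ.∣ p ∣ ℚ.≤ 1ℚ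
p²≤1⇒∣p∣≤1 p p²≤1 with ℚ.∣ p ∣ ℚₚ.≤? 1ℚ
... | yes le = le
... | no ¬le = contradiction (ℚₚ.<-≤-trans 1<p² p²≤1) (ℚₚ.<-irrefl refl)
  where
  1<∣p∣ = ℚₚ.≰⇒> ¬le
  0≤∣p∣ = ℚₚ.0≤∣p∣ p
  1<p² : 1ℚ ℚ.< p ℚ.* p
  1<p² = subst (1ℚ ℚ.<_) (∣p∣*∣p∣ p) (ℚₚ.<-≤-trans 1<∣p∣
    (subst (ℚ._≤ ℚ.∣ p ∣ ℚ.* ℚ.∣ p ∣) (ℚₚ.*-identityʳ ℚ.∣ p ∣)
      (ℚₚ.*-monoˡ-≤-nonNeg ℚ.∣ p ∣ {{ℚ.nonNegative 0≤∣p∣}} (ℚₚ.<⇒≤ 1<∣p∣))))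

∑ : Vector ℚ d → ℚ
∑ = foldr ℚ._+_ 0ℚ

∑-mono : {a b : Vector ℚ d} → (∀ k → a k ℚ.≤ b k) → ∑ a ℚ.≤ ∑ b
∑-mono {zero}  a≤b = ℚₚ.≤-refl
∑-mono {suc d} a≤b = ℚₚ.+-mono-≤ (a≤b zero) (∑-mono (a≤b ∘ suc))

∑-cong : {a b : Vector ℚ d} → (∀ k → a k ≡ b k) → ∑ a ≡ ∑ b
∑-cong {zero}  a≗b = refl
∑-cong {suc d} a≗b = cong₂ ℚ._+_ (a≗b zero) (∑-cong (a≗b ∘ suc))

∑-nonNeg : {a : Vector ℚ d} → (∀ k → 0ℚ ℚ.≤ a k) → 0ℚ ℚ.≤ ∑ a
∑-nonNeg {zero}  0≤a = ℚₚ.≤-refl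
∑-nonNeg {suc d} 0≤a = +-nonNeg (0≤a zero) (∑-nonNeg (0≤a ∘ suc))

term≤∑ : {a : Vector ℚ d} → (∀ k → 0ℚ ℚ.≤ a k) → ∀ k → a k ℚ.≤ ∑ a
term≤∑ {a = a} 0≤a zero    = ≤-cert (∑-nonNeg (0≤a ∘ suc)) refl
term≤∑ {a = a} 0≤a (suc k) = ℚₚ.≤-trans (term≤∑ (0≤a ∘ suc) k)
  (≤-cert (0≤a zero) (ℚₚ.+-comm (∑ (a ∘ suc)) (a zero)))

∑-affine : ∀ t u (a : Vector ℚ d) → ∑ (λ k → t ℚ.* a k ℚ.+ u) ≡ t ℚ.* ∑ a ℚ.+ R.fromℕ d ℚ.* u
∑-affine {zero}  t u a = solve 2 (λ t u → con 0ℚ := t :* con 0ℚ :+ con 0ℚ :* u) refl t u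
∑-affine {suc d} t u a = trans (cong (t ℚ.* a zero ℚ.+ u ℚ.+_) (∑-affine t u (a ∘ suc)))
  (trans (solve 5 (λ t u x s n → t :* x :+ u :+ (t :* s :+ n :* u) := t :* (x :+ s) :+ (con 1ℚ :+ n) :* u)
           refl t u (a zero) (∑ (a ∘ suc)) (R.fromℕ d))
    (cong (λ n → t ℚ.* (a zero ℚ.+ ∑ (a ∘ suc)) ℚ.+ n ℚ.* u) (sym (R.fromℕ-suc d))))

norm² : Vector ℚ d → ℚ
norm² a = ∑ (λ k → a k ℚ.* a k)

dist² : Vector ℚ d → Vector ℚ d → ℚ
dist² a b = norm² (λ k → a k ℚ.- b k)

norm²-nonNeg : ∀ (a : Vector ℚ d) → 0ℚ ℚ.≤ norm² a
norm²-nonNeg a = ∑-nonNeg (λ k → square-nonNeg (a k))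

norm²-perturb : ∀ {Δ} {a b : Vector ℚ d} → 0ℚ ℚ.≤ Δ → Δ ℚ.≤ 1ℚ → (∀ k → ℚ.∣ b k ℚ.- a k ∣ ℚ.≤ Δ) →
                norm² b ℚ.≤ (1ℚ ℚ.+ Δ) ℚ.* norm² a ℚ.+ R.fromℕ d ℚ.* (Δ ℚ.+ Δ)
norm²-perturb {d} {Δ} {a} {b} 0≤Δ Δ≤1 b-a≤Δ = subst (norm² b ℚ.≤_)
  (∑-affine (1ℚ ℚ.+ Δ) (Δ ℚ.+ Δ) (λ k → a k ℚ.* a k)) (∑-mono (λ k → term (a k) (b k) (b-a≤Δ k)))
  where
  term : ∀ x y → ℚ.∣ y ℚ.- x ∣ ℚ.≤ Δ → y ℚ.* y ℚ.≤ (1ℚ ℚ.+ Δ) ℚ.* (x ℚ.* x) ℚ.+ (Δ ℚ.+ Δ)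
  -- With e = y - x, the first two terms encode 2|xe| ≤ Δ(x² + 1), the other two e² ≤ Δ² ≤ Δ.
  term x y h = ≤-cert
    (+-nonNeg (+-nonNeg (+-nonNeg
      (*-nonNeg 0≤½ (*-nonNeg (0≤q-p (∣p∣≤⇒p≤ h)) (square-nonNeg (x ℚ.+ 1ℚ))))
      (*-nonNeg 0≤½ (*-nonNeg (0≤q-p (∣p∣≤⇒-p≤ h)) (square-nonNeg (x ℚ.- 1ℚ)))))
      (*-nonNeg (0≤q-p (∣p∣≤⇒p≤ h)) (0≤q-p (∣p∣≤⇒-p≤ h))))
      (*-nonNeg 0≤Δ (0≤q-p Δ≤1)))
    (solve 3 (λ x y Δ → y :* y :+ (con ½ :* ((Δ :- (y :- x)) :* ((x :+ con 1ℚ) :* (x :+ con 1ℚ)))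
        :+ con ½ :* ((Δ :- (:- (y :- x))) :* ((x :- con 1ℚ) :* (x :- con 1ℚ)))
        :+ (Δ :- (y :- x)) :* (Δ :- (:- (y :- x))) :+ Δ :* (con 1ℚ :- Δ))
        := (con 1ℚ :+ Δ) :* (x :* x) :+ (Δ :+ Δ)) refl x y Δ)
    where
    0≤½ : 0ℚ ℚ.≤ ½
    0≤½ = ℚₚ.nonNegative⁻¹ ½

dist²-coord : ∀ {a b : Vector ℚ d} → dist² a b ℚ.≤ 1ℚ → ∀ k → ℚ.∣ a k ℚ.- b k ∣ ℚ.≤ 1ℚ
dist²-coord {a = a} {b} h k = p²≤1⇒∣p∣≤1 (a k ℚ.- b k)
  (ℚₚ.≤-trans (term≤∑ (λ k → square-nonNeg (a k ℚ.- b k)) k) h)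

dist²-sym : ∀ (a b : Vector ℚ d) → dist² a b ≡ dist² b a
dist²-sym a b = ∑-cong (λ k → solve 2 (λ x y → (x :- y) :* (x :- y) := (y :- x) :* (y :- x)) refl (a k) (b k))

dist²-refl : ∀ (a : Vector ℚ d) → dist² a a ≡ 0ℚ
dist²-refl {zero}  a = refl
dist²-refl {suc d} a = cong₂ ℚ._+_ (solve 1 (λ x → (x :- x) :* (x :- x) := con 0ℚ) refl (a zero)) (dist²-refl (a ∘ suc))

blend : ℚ → Vector ℚ d → Vector ℚ d → Vector ℚ d
blend t m x k = m k ℚ.+ t ℚ.* (x k ℚ.- m k)

-- The quadratic terms in `x` cancel, which makes this affine in `x`.
power : Vector ℚ d → Vector ℚ d → Vector ℚ d → ℚ
power z c x = dist² z x ℚ.- dist² c x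

power-blend : ∀ t (z c m x : Vector ℚ d) →
              power z c (blend t m x) ≡ (1ℚ ℚ.- t) ℚ.* power z c m ℚ.+ t ℚ.* power z c x
power-blend {zero}  t z c m x = solve 1 (λ t → con 0ℚ := (con 1ℚ :- t) :* con 0ℚ :+ t :* con 0ℚ) refl t
power-blend {suc d} t z c m x = begin
  (B₀ ℚ.+ B₁) ℚ.- (B₂ ℚ.+ B₃)
    ≡⟨ solve 4 (λ a b c e → (a :+ b) :- (c :+ e) := (a :- c) :+ (b :- e)) refl B₀ B₁ B₂ B₃ ⟩
  (B₀ ℚ.- B₂) ℚ.+ power (z ∘ suc) (c ∘ suc) (blend t m x ∘ suc)
    ≡⟨ cong ((B₀ ℚ.- B₂) ℚ.+_) (power-blend t (z ∘ suc) (c ∘ suc) (m ∘ suc) (x ∘ suc)) ⟩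
  (B₀ ℚ.- B₂) ℚ.+ ((1ℚ ℚ.- t) ℚ.* (M₁ ℚ.- M₃) ℚ.+ t ℚ.* (X₁ ℚ.- X₃))
    ≡⟨ solve 9 (λ t z c m x M₁ M₃ X₁ X₃ →
         ((z :- (m :+ t :* (x :- m))) :* (z :- (m :+ t :* (x :- m)))
          :- (c :- (m :+ t :* (x :- m))) :* (c :- (m :+ t :* (x :- m))))
         :+ ((con 1ℚ :- t) :* (M₁ :- M₃) :+ t :* (X₁ :- X₃))
         := (con 1ℚ :- t) :* (((z :- m) :* (z :- m) :+ M₁) :- ((c :- m) :* (c :- m) :+ M₃))
         :+ t :* (((z :- x) :* (z :- x) :+ X₁) :- ((c :- x) :* (c :- x) :+ X₃)))
         refl t (z zero) (c zero) (m zero) (x zero) M₁ M₃ X₁ X₃ ⟩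
  (1ℚ ℚ.- t) ℚ.* power z c m ℚ.+ t ℚ.* power z c x ∎
  where
  open ≡-Reasoning
  b = blend t m x
  B₀ = (z zero ℚ.- b zero) ℚ.* (z zero ℚ.- b zero)
  B₁ = dist² (z ∘ suc) (b ∘ suc)
  B₂ = (c zero ℚ.- b zero) ℚ.* (c zero ℚ.- b zero)
  B₃ = dist² (c ∘ suc) (b ∘ suc)
  M₁ = dist² (z ∘ suc) (m ∘ suc)
  M₃ = dist² (c ∘ suc) (m ∘ suc)
  X₁ = dist² (z ∘ suc) (x ∘ suc)
  X₃ = dist² (c ∘ suc) (x ∘ suc)

-- Lipschitz functions and blending

clamp : ℚ → ℚ
clamp p = 0ℚ ℚ.⊔ (1ℚ ℚ.⊓ p)

0≤1 : 0ℚ ℚ.≤ 1ℚ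
0≤1 = ℚₚ.nonNegative⁻¹ 1ℚ

0≤clamp : ∀ p → 0ℚ ℚ.≤ clamp p
0≤clamp p = ℚₚ.p≤p⊔q 0ℚ (1ℚ ℚ.⊓ p)

clamp≤1 : ∀ p → clamp p ℚ.≤ 1ℚ
clamp≤1 p = ℚₚ.⊔-lub 0≤1 (ℚₚ.p⊓q≤p 1ℚ p)

clamp-1 : 1ℚ ℚ.≤ p → clamp p ≡ 1ℚ
clamp-1 1≤p = trans (cong (0ℚ ℚ.⊔_) (ℚₚ.p≤q⇒p⊓q≡p 1≤p)) refl

clamp-0 : p ℚ.≤ 0ℚ → clamp p ≡ 0ℚ
clamp-0 p≤0 = ℚₚ.p≥q⇒p⊔q≡p (ℚₚ.≤-trans (ℚₚ.p⊓q≤q 1ℚ _) p≤0)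

clamp-mono-+ : 0ℚ ℚ.≤ ε → p ℚ.≤ q ℚ.+ ε → clamp p ℚ.≤ clamp q ℚ.+ ε
clamp-mono-+ {ε} {p} {q} 0≤ε p≤q+ε = ℚₚ.⊔-lub
  (+-nonNeg (0≤clamp q) 0≤ε)
  (subst (1ℚ ℚ.⊓ p ℚ.≤_) (sym (ℚₚ.mono-≤-distrib-⊔ (ℚₚ.+-monoˡ-≤ ε) 0ℚ (1ℚ ℚ.⊓ q)))
    (ℚₚ.≤-trans (subst (1ℚ ℚ.⊓ p ℚ.≤_) (sym (ℚₚ.mono-≤-distrib-⊓ (ℚₚ.+-monoˡ-≤ ε) 1ℚ q))
        (ℚₚ.⊓-mono-≤ {1ℚ} {1ℚ ℚ.+ ε} (≤-cert 0≤ε refl) p≤q+ε))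
      (ℚₚ.p≤q⊔p (0ℚ ℚ.+ ε) ((1ℚ ℚ.⊓ q) ℚ.+ ε))))

∣p-q∣≤⇒p≤q+ : ∀ {p q r} → ℚ.∣ p ℚ.- q ∣ ℚ.≤ r → p ℚ.≤ q ℚ.+ r
∣p-q∣≤⇒p≤q+ {p} {q} {r} h = ≤-cert (0≤q-p (∣p∣≤⇒p≤ h))
  (solve 3 (λ p q r → p :+ (r :- (p :- q)) := q :+ r) refl p q r)

p≤q+⇒∣p-q∣≤ : ∀ {p q r} → p ℚ.≤ q ℚ.+ r → q ℚ.≤ p ℚ.+ r → ℚ.∣ p ℚ.- q ∣ ℚ.≤ r
p≤q+⇒∣p-q∣≤ {p} {q} {r} h h′ = ∣p∣≤q
  (≤-cert (0≤q-p h) (solve 3 (λ p q r → (p :- q) :+ ((q :+ r) :- p) := r) refl p q r))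
  (≤-cert (0≤q-p h′) (solve 3 (λ p q r → (:- (p :- q)) :+ ((p :+ r) :- q) := r) refl p q r))

clamp-lipschitz : ∀ p q → ℚ.∣ clamp p ℚ.- clamp q ∣ ℚ.≤ ℚ.∣ p ℚ.- q ∣
clamp-lipschitz p q = p≤q+⇒∣p-q∣≤
  (clamp-mono-+ {q = q} (ℚₚ.0≤∣p∣ (p ℚ.- q)) (∣p-q∣≤⇒p≤q+ {p} {q} ℚₚ.≤-refl))
  (clamp-mono-+ {q = p} (ℚₚ.0≤∣p∣ (p ℚ.- q)) (∣p-q∣≤⇒p≤q+ {q} {p} (ℚₚ.≤-reflexive (∣p-q∣≡∣q-p∣ q p))))

Box : ℚ → Vector ℚ d → Set
Box R c = ∀ k → ℚ.∣ c k ∣ ℚ.≤ R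

Close : ℚ → Vector ℚ d → Vector ℚ d → Set
Close η a b = ∀ k → ℚ.∣ a k ℚ.- b k ∣ ℚ.≤ η

-- The bound on the values travels with the slope because products need both. The constants are data
-- since the grid of `Zero` is built from them.
record Lipschitz (R : ℚ) (f : Vector ℚ d → ℚ) : Set where
  constructor lip
  field
    slope range : ℚ
    0≤slope     : 0ℚ ℚ.≤ slope
    0≤range     : 0ℚ ℚ.≤ range
    ∣f∣≤range   : ∀ {c} → Box R c → ℚ.∣ f c ∣ ℚ.≤ range
    lipschitz   : ∀ {c c′ η} → Box R c → Box R c′ → 0ℚ ℚ.≤ η → Close η c c′ →
                ℚ.∣ f c ℚ.- f c′ ∣ ℚ.≤ slope ℚ.* η

open Lipschitz public

const-lip : ∀ p → Lipschitz {d} R (λ _ → p)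
const-lip p = lip 0ℚ ℚ.∣ p ∣ ℚₚ.≤-refl (ℚₚ.0≤∣p∣ p) (λ _ → ℚₚ.≤-refl)
  (λ {_} {_} {η} _ _ _ _ → ℚₚ.≤-reflexive (trans (cong ℚ.∣_∣ (ℚₚ.+-inverseʳ p)) (sym (ℚₚ.*-zeroˡ η))))

coord-lip : 0ℚ ℚ.≤ R → ∀ k → Lipschitz {d} R (λ c → c k)
coord-lip 0≤R k = lip 1ℚ _ 0≤1 0≤R (λ box → box k)
  (λ {_} {_} {η} _ _ _ close → subst (_ ℚ.≤_) (sym (ℚₚ.*-identityˡ η)) (close k))

+-lip : ∀ {f g : Vector ℚ d → ℚ} → Lipschitz R f → Lipschitz R g → Lipschitz R (λ c → f c ℚ.+ g c)
+-lip {f = f} {g} F G = lip (slope F ℚ.+ slope G) (range F ℚ.+ range G) (+-nonNeg (0≤slope F) (0≤slope G)) (+-nonNeg (0≤range F) (0≤range G))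
  (λ {c} box → ℚₚ.≤-trans (ℚₚ.∣p+q∣≤∣p∣+∣q∣ (f c) (g c)) (ℚₚ.+-mono-≤ (∣f∣≤range F box) (∣f∣≤range G box)))
  (λ {c} {c′} {η} box box′ 0≤η close → begin
    ℚ.∣ (f c ℚ.+ g c) ℚ.- (f c′ ℚ.+ g c′) ∣
      ≡⟨ cong ℚ.∣_∣ (solve 4 (λ a b c e → (a :+ b) :- (c :+ e) := (a :- c) :+ (b :- e)) refl (f c) (g c) (f c′) (g c′)) ⟩
    ℚ.∣ (f c ℚ.- f c′) ℚ.+ (g c ℚ.- g c′) ∣
      ≤⟨ ℚₚ.∣p+q∣≤∣p∣+∣q∣ (f c ℚ.- f c′) (g c ℚ.- g c′) ⟩
    ℚ.∣ f c ℚ.- f c′ ∣ ℚ.+ ℚ.∣ g c ℚ.- g c′ ∣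
      ≤⟨ ℚₚ.+-mono-≤ (lipschitz F box box′ 0≤η close) (lipschitz G box box′ 0≤η close) ⟩
    slope F ℚ.* η ℚ.+ slope G ℚ.* η
      ≡⟨ sym (ℚₚ.*-distribʳ-+ η (slope F) (slope G)) ⟩
    (slope F ℚ.+ slope G) ℚ.* η ∎)
  where open ℚₚ.≤-Reasoning

*-lip : ∀ {f g : Vector ℚ d → ℚ} → Lipschitz R f → Lipschitz R g → Lipschitz R (λ c → f c ℚ.* g c)
*-lip {f = f} {g} F G = lip (range F ℚ.* slope G ℚ.+ range G ℚ.* slope F) (range F ℚ.* range G)
  (+-nonNeg (*-nonNeg (0≤range F) (0≤slope G)) (*-nonNeg (0≤range G) (0≤slope F)))
  (*-nonNeg (0≤range F) (0≤range G))
  (λ box → ∣p*q∣≤ (∣f∣≤range F box) (∣f∣≤range G box))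
  (λ {c} {c′} {η} box box′ 0≤η close → begin
    ℚ.∣ f c ℚ.* g c ℚ.- f c′ ℚ.* g c′ ∣
      ≡⟨ cong ℚ.∣_∣ (solve 4 (λ a b c e → a :* b :- c :* e := a :* (b :- e) :+ e :* (a :- c)) refl (f c) (g c) (f c′) (g c′)) ⟩
    ℚ.∣ f c ℚ.* (g c ℚ.- g c′) ℚ.+ g c′ ℚ.* (f c ℚ.- f c′) ∣
      ≤⟨ ℚₚ.∣p+q∣≤∣p∣+∣q∣ (f c ℚ.* (g c ℚ.- g c′)) (g c′ ℚ.* (f c ℚ.- f c′)) ⟩
    ℚ.∣ f c ℚ.* (g c ℚ.- g c′) ∣ ℚ.+ ℚ.∣ g c′ ℚ.* (f c ℚ.- f c′) ∣
      ≤⟨ ℚₚ.+-mono-≤ (∣p*q∣≤ (∣f∣≤range F box) (lipschitz G box box′ 0≤η close))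
                     (∣p*q∣≤ (∣f∣≤range G box′) (lipschitz F box box′ 0≤η close)) ⟩
    range F ℚ.* (slope G ℚ.* η) ℚ.+ range G ℚ.* (slope F ℚ.* η)
      ≡⟨ solve 5 (λ a b c e h → a :* (b :* h) :+ c :* (e :* h) := (a :* b :+ c :* e) :* h) refl (range F) (slope G) (range G) (slope F) η ⟩
    (range F ℚ.* slope G ℚ.+ range G ℚ.* slope F) ℚ.* η ∎)
  where open ℚₚ.≤-Reasoning

neg-lip : ∀ {g : Vector ℚ d → ℚ} → Lipschitz R g → Lipschitz R (λ c → ℚ.- g c)
neg-lip {g = g} G = lip (slope G) (range G) (0≤slope G) (0≤range G)
  (λ box → subst (ℚ._≤ range G) (sym (ℚₚ.∣-p∣≡∣p∣ _)) (∣f∣≤range G box))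
  (λ {c} {c′} {η} box box′ 0≤η close → subst (ℚ._≤ slope G ℚ.* η)
    (trans (∣p-q∣≡∣q-p∣ (g c) (g c′)) (cong ℚ.∣_∣ (solve 2 (λ a b → b :- a := (:- a) :- (:- b)) refl (g c) (g c′))))
    (lipschitz G box box′ 0≤η close))

-‿lip : ∀ {f g : Vector ℚ d → ℚ} → Lipschitz R f → Lipschitz R g → Lipschitz R (λ c → f c ℚ.- g c)
-‿lip {f = f} {g} F G = +-lip F (neg-lip G)

clamp-lip : ∀ {f : Vector ℚ d → ℚ} → Lipschitz R f → Lipschitz R (λ c → clamp (f c))
clamp-lip {f = f} F = lip (slope F) 1ℚ (0≤slope F) 0≤1
  (λ {c} _ → subst (ℚ._≤ 1ℚ) (sym (ℚₚ.0≤p⇒∣p∣≡p (0≤clamp (f c)))) (clamp≤1 (f c)))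
  (λ {c} {c′} box box′ 0≤η close →
    ℚₚ.≤-trans (clamp-lipschitz (f c) (f c′)) (lipschitz F box box′ 0≤η close))

∑-lip : ∀ {m} {f : Vector ℚ d → Vector ℚ m} → (∀ k → Lipschitz R (λ c → f c k)) → Lipschitz R (λ c → ∑ (f c))
∑-lip {m = zero}  F = const-lip 0ℚ
∑-lip {m = suc m} F = +-lip (F zero) (∑-lip (F ∘ suc))


∘-lip : ∀ {m R′} {f : Vector ℚ d → ℚ} {g : Vector ℚ m → Vector ℚ d} →
        Lipschitz R f → (∀ k → Lipschitz R′ (λ c → g c k)) → (∀ {c} → Box R′ c → Box R (g c)) →
        Lipschitz R′ (f ∘ g)
∘-lip {f = f} {g} F G G-box = lip (slope F ℚ.* S) (range F) (*-nonNeg (0≤slope F) 0≤S) (0≤range F)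
  (λ box → ∣f∣≤range F (G-box box))
  (λ {c} {c′} {η} box box′ 0≤η close →
    subst (ℚ.∣ f (g c) ℚ.- f (g c′) ∣ ℚ.≤_) (sym (ℚₚ.*-assoc (slope F) S η))
      (lipschitz F (G-box box) (G-box box′) (*-nonNeg 0≤S 0≤η)
        (λ k → ℚₚ.≤-trans (lipschitz (G k) box box′ 0≤η close)
          (ℚₚ.*-monoʳ-≤-nonNeg η {{ℚ.nonNegative 0≤η}} (term≤∑ (λ k → 0≤slope (G k)) k)))))
  where
  S = ∑ (λ k → slope (G k))
  0≤S = ∑-nonNeg (λ k → 0≤slope (G k))

module Blending {S : Set} (point : S → Vector ℚ d) (slack : S → ℚ) (slack>0 : ∀ s → 0ℚ ℚ.< slack s) where

  -- Between the two balls `depth` falls from 1 to 0, with slope `1 / slack` in the squared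
  -- distance; this is the room for a Lipschitz weight that is 1 on `Core` and 0 off `Inside`.
  Inside Core : Vector ℚ d → S → Set
  Inside c s = dist² c (point s) ℚ.≤ 1ℚ ℚ.- slack s
  Core   c s = dist² c (point s) ℚ.≤ 1ℚ ℚ.- (slack s ℚ.+ slack s)

  steepness : S → ℚ
  steepness s = proj₁ (quotient 1ℚ (slack s) (ℚₚ.positive⁻¹ 1ℚ) (slack>0 s))

  0≤steepness : ∀ s → 0ℚ ℚ.≤ steepness s
  0≤steepness s = ℚₚ.<⇒≤ (proj₁ (proj₂ (quotient 1ℚ (slack s) (ℚₚ.positive⁻¹ 1ℚ) (slack>0 s))))

  slack*steepness : ∀ s → slack s ℚ.* steepness s ≡ 1ℚ
  slack*steepness s = proj₂ (proj₂ (quotient 1ℚ (slack s) (ℚₚ.positive⁻¹ 1ℚ) (slack>0 s)))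

  depth : Vector ℚ d → S → ℚ
  depth c s = steepness s ℚ.* (1ℚ ℚ.- slack s ℚ.- dist² c (point s))

  weight : Vector ℚ d → S → ℚ
  weight c s = clamp (depth c s)

  weight-core : ∀ {c s} → Core c s → weight c s ≡ 1ℚ
  weight-core {c} {s} core = clamp-1 {depth c s} (≤-cert (*-nonNeg (0≤steepness s) (0≤q-p core))
    (trans (cong (ℚ._+ (α ℚ.* ((1ℚ ℚ.- (e ℚ.+ e)) ℚ.- D))) (sym (slack*steepness s)))
      (solve 3 (λ α e D → e :* α :+ α :* ((con 1ℚ :- (e :+ e)) :- D) := α :* (con 1ℚ :- e :- D)) refl α e D)))
    where
    α = steepness s
    e = slack s
    D = dist² c (point s)

  weight-outside : ∀ {c s} → 1ℚ ℚ.- slack s ℚ.≤ dist² c (point s) → weight c s ≡ 0ℚ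
  weight-outside {c} {s} out = clamp-0 {depth c s} (≤-cert (*-nonNeg (0≤steepness s) (0≤q-p out))
    (solve 3 (λ α a D → α :* (a :- D) :+ α :* (D :- a) := con 0ℚ) refl
      (steepness s) (1ℚ ℚ.- slack s) (dist² c (point s))))

  -- Iterated blending gives a partition of unity without dividing by the total weight. A sample
  -- with `c` in its core has weight 1 and erases whatever the rest of the list produced, in
  -- particular the default `c` at its end.
  centre : List S → Vector ℚ d → Vector ℚ d
  centre []      c = c
  centre (s ∷ L) c = blend (weight c s) (centre L c) (point s)

  -- centre L c lies in the convex hull of the points of L in the unit ball
  -- around c, and power z c is affine.
  centre-hull : ∀ z c L → Any (Core c) L →
                ∃ λ s → Inside c s × power z c (point s) ℚ.≤ power z c (centre L c)
  centre-hull z c (s ∷ L) (here core) = s , inside , ℚₚ.≤-reflexive (sym eq)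
    where
    t = weight c s
    Pₘ = power z c (centre L c)
    Pₛ = power z c (point s)
    inside = ℚₚ.≤-trans core (≤-cert (ℚₚ.<⇒≤ (slack>0 s))
      (solve 1 (λ e → con 1ℚ :- (e :+ e) :+ e := con 1ℚ :- e) refl (slack s)))
    eq : power z c (centre (s ∷ L) c) ≡ Pₛ
    eq = trans (power-blend t z c (centre L c) (point s))
      (trans (cong (λ t → (1ℚ ℚ.- t) ℚ.* Pₘ ℚ.+ t ℚ.* Pₛ) (weight-core {c} {s} core))
        (solve 2 (λ m x → (con 1ℚ :- con 1ℚ) :* m :+ con 1ℚ :* x := x) refl Pₘ Pₛ))
  centre-hull z c (s ∷ L) (there core) with centre-hull z c L core | dist² c (point s) ℚₚ.≤? 1ℚ ℚ.- slack s
  ... | s′ , inside′ , le | no outside = s′ , inside′ , subst (power z c (point s′) ℚ.≤_) (sym eq) le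
    where
    Pₘ = power z c (centre L c)
    Pₛ = power z c (point s)
    eq : power z c (centre (s ∷ L) c) ≡ Pₘ
    eq = trans (power-blend (weight c s) z c (centre L c) (point s))
      (trans (cong (λ t → (1ℚ ℚ.- t) ℚ.* Pₘ ℚ.+ t ℚ.* Pₛ) (weight-outside {c} {s} (ℚₚ.<⇒≤ (ℚₚ.≰⇒> outside))))
        (solve 2 (λ m x → (con 1ℚ :- con 0ℚ) :* m :+ con 0ℚ :* x := m) refl Pₘ Pₛ))
  -- A convex combination is at least the smaller of its two ends.
  ... | s′ , inside′ , le | yes inside with ℚₚ.≤-total (power z c (point s)) (power z c (centre L c))
  ...   | inj₁ s≤m = s , inside , ≤-cert (*-nonNeg (0≤q-p (clamp≤1 (depth c s))) (0≤q-p s≤m))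
    (trans (solve 3 (λ t m x → x :+ (con 1ℚ :- t) :* (m :- x) := (con 1ℚ :- t) :* m :+ t :* x) refl
              (weight c s) (power z c (centre L c)) (power z c (point s)))
      (sym (power-blend (weight c s) z c (centre L c) (point s))))
  ...   | inj₂ m≤s = s′ , inside′ , ℚₚ.≤-trans le (≤-cert (*-nonNeg (0≤clamp (depth c s)) (0≤q-p m≤s))
    (trans (solve 3 (λ t m x → m :+ t :* (x :- m) := (con 1ℚ :- t) :* m :+ t :* x) refl
              (weight c s) (power z c (centre L c)) (power z c (point s)))
      (sym (power-blend (weight c s) z c (centre L c) (point s)))))

  -- With `z` the centre `m` itself, `centre-hull` yields `dist² m s - dist² c s ≤ - dist² c m`, so
  -- `m` is no farther from `c` than a sample inside the ball.
  centre-near : ∀ c L → Any (Core c) L → Close 1ℚ (centre L c) c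
  centre-near c L core k with centre-hull (centre L c) c L core
  ... | s , inside , le = subst (ℚ._≤ 1ℚ) (∣p-q∣≡∣q-p∣ (c k) (centre L c k)) (dist²-coord {a = c} {m} (ℚₚ.≤-trans D≤ inside≤1) k)
    where
    m = centre L c
    inside≤1 = ℚₚ.≤-trans inside (≤-cert (ℚₚ.<⇒≤ (slack>0 s)) (solve 1 (λ e → con 1ℚ :- e :+ e := con 1ℚ) refl (slack s)))
    D≤ : dist² c m ℚ.≤ dist² c (point s)
    D≤ = ≤-cert (+-nonNeg (0≤q-p le) (norm²-nonNeg (λ k → m k ℚ.- point s k)))
      (trans (cong (λ D → dist² c m ℚ.+ (((D ℚ.- dist² c m) ℚ.- (dist² m (point s) ℚ.- dist² c (point s))) ℚ.+ dist² m (point s))) (dist²-refl m))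
        (solve 3 (λ a b x → a :+ (((con 0ℚ :- a) :- (b :- x)) :+ b) := x) refl (dist² c m) (dist² m (point s)) (dist² c (point s))))

  -- For the sample of `centre-hull`, `dist² z s` is at most `dist² z m + dist² c s - dist² c m`.
  -- The first term is at most `1 - ε` by hypothesis, the second at most `1 - slack s`, and the
  -- third is dropped.
  centre-step : ∀ z c L {ε} → Any (Core c) L → dist² z (centre L c) ℚ.≤ 1ℚ ℚ.- ε →
                ∃ λ s → Inside c s × dist² z (point s) ℚ.≤ 1ℚ ℚ.+ 1ℚ ℚ.- (ε ℚ.+ slack s)
  centre-step z c L {ε} core z-near with centre-hull z c L core
  ... | s , inside , le = s , inside , ≤-cert
    (+-nonNeg (+-nonNeg (0≤q-p le) (0≤q-p z-near)) (+-nonNeg (0≤q-p inside) (norm²-nonNeg (λ k → c k ℚ.- centre L c k))))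
    (solve 6 (λ zs cs zm cm e ε → zs :+ (((zm :- cm) :- (zs :- cs)) :+ ((con 1ℚ :- ε) :- zm) :+ (((con 1ℚ :- e) :- cs) :+ cm))
       := con 1ℚ :+ con 1ℚ :- (ε :+ e)) refl
       (dist² z (point s)) (dist² c (point s)) (dist² z (centre L c)) (dist² c (centre L c)) (slack s) ε)

  dist²-lip : ∀ {R} → 0ℚ ℚ.≤ R → ∀ p → Lipschitz {d} R (λ c → dist² c p)
  dist²-lip 0≤R p = ∑-lip (λ k → *-lip (coord- k) (coord- k))
    where coord- = λ k → -‿lip (coord-lip 0≤R k) (const-lip (p k))

  centre-lip : ∀ {R} → 0ℚ ℚ.≤ R → ∀ L k → Lipschitz R (λ c → centre L c k)
  centre-lip 0≤R []      k = coord-lip 0≤R k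
  centre-lip 0≤R (s ∷ L) k = +-lip (centre-lip 0≤R L k)
    (*-lip (clamp-lip (*-lip (const-lip (steepness s)) (-‿lip (const-lip (1ℚ ℚ.- slack s)) (dist²-lip 0≤R (point s)))))
      (-‿lip (const-lip (point s k)) (centre-lip 0≤R L k)))

-- Real points and their rational approximations

Eventually : (ℕ → Set) → Set
Eventually P = ∃ λ N → ∀ n → N ℕ.≤ n → P n

_⊓ᵉ_ : ∀ {P Q : ℕ → Set} → Eventually P → Eventually Q → Eventually (λ n → P n × Q n)
(M , p) ⊓ᵉ (N , q) = M ℕ.⊔ N , λ n h → p n (ℕₚ.m⊔n≤o⇒m≤o M N h) , q n (ℕₚ.m⊔n≤o⇒n≤o M N h)

mapᵉ : ∀ {P Q : ℕ → Set} → (∀ {n} → P n → Q n) → Eventually P → Eventually Q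
mapᵉ f (N , p) = N , λ n h → f (p n h)

allᵉ : ∀ {P : Fin d → ℕ → Set} → (∀ k → Eventually (P k)) → Eventually (λ n → ∀ k → P k n)
allᵉ {zero}  p = 0 , λ _ _ ()
allᵉ {suc d} p = mapᵉ (λ (p₀ , ps) → λ { zero → p₀ ; (suc k) → ps k }) (p zero ⊓ᵉ allᵉ (p ∘ suc))

at : Point d → ℕ → Vector ℚ d
at P n k = seq (P k) n

seq-norm² : ∀ (v : Point d) n → seq (foldr _+_ 0ℝ (λ i → v i * v i)) n ≡ norm² (at v n)
seq-norm² {zero}  v n = refl
seq-norm² {suc d} v n = cong (seq (v zero) n ℚ.* seq (v zero) n ℚ.+_) (seq-norm² (v ∘ suc) n)

2ℚ : ℚ
2ℚ = 1ℚ ℚ.+ 1ℚ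

‖‖≤√2 : ∀ (v : Point d) → Eventually (λ n → norm² (at v n) ℚ.≤ 2ℚ) → ‖ v ‖ ≤ √ 2ℝ
‖‖≤√2 v v≤2 ε 0<ε = from-bounds (v≤2 ⊓ᵉ halves→0 (1ℚ ℚ.+ 2ℚ) e (ℚₚ.positive⁻¹ (1ℚ ℚ.+ 2ℚ)) 0<e)
  where
  open ℚₚ.≤-Reasoning
  e = ½ ℚ.* ε
  0<e = half-pos 0<ε
  a = λ n → seq (foldr _+_ 0ℝ (λ i → v i * v i)) n
  0≤2 : 0ℚ ℚ.≤ 2ℚ
  0≤2 = ℚₚ.nonNegative⁻¹ 2ℚ
  bound : ∀ n → norm² (at v n) ℚ.≤ 2ℚ → 0ℚ ℚ.⊔ a n ℚ.< (0ℚ ℚ.⊔ 2ℚ) ℚ.+ e ℚ.* e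
  bound n h = begin-strict
    0ℚ ℚ.⊔ a n                  ≤⟨ ℚₚ.⊔-monoʳ-≤ 0ℚ (subst (ℚ._≤ 2ℚ) (sym (seq-norm² v n)) h) ⟩
    0ℚ ℚ.⊔ 2ℚ                   ≡⟨ sym (ℚₚ.+-identityʳ (0ℚ ℚ.⊔ 2ℚ)) ⟩
    (0ℚ ℚ.⊔ 2ℚ) ℚ.+ 0ℚ          <⟨ ℚₚ.+-monoʳ-< (0ℚ ℚ.⊔ 2ℚ) (*-pos 0<e 0<e) ⟩
    (0ℚ ℚ.⊔ 2ℚ) ℚ.+ e ℚ.* e     ∎
  from-bounds : Eventually (λ n → norm² (at v n) ℚ.≤ 2ℚ × (1ℚ ℚ.+ 2ℚ) ℚ.* halves n ℚ.< e) →
          Eventually (λ n → seq ‖ v ‖ n ℚ.< seq (√ 2ℝ) n ℚ.+ ε)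
  from-bounds (N , f) = N , λ n h → let a≤2 , small = f n h in
    subst (λ t → seq ‖ v ‖ n ℚ.< seq (√ 2ℝ) n ℚ.+ t) (half+half ε)
      (bracket-close (bisect-bracket (0ℚ ℚ.⊔ a n) (ℚₚ.p≤p⊔q 0ℚ (a n)) n)
        (bisect-bracket (0ℚ ℚ.⊔ 2ℚ) 0≤2 n) 0<e (bound n a≤2) small)

-- The gap in the norm survives squaring because `u ≤ 1` gives u² ≤ u.
bracket<1 : ∀ {a l u ε} → 0ℚ ℚ.≤ u → a ℚ.≤ u ℚ.* u → u ℚ.- l ℚ.≤ ½ ℚ.* ε → l ℚ.+ ε ℚ.≤ 1ℚ → 0ℚ ℚ.< ε →
            a ℚ.≤ 1ℚ ℚ.- ½ ℚ.* ε
bracket<1 {a} {l} {u} {ε} 0≤u a≤u² gap l+ε≤1 0<ε = ℚₚ.≤-trans a≤u² (ℚₚ.≤-trans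
  (≤-cert (*-nonNeg 0≤u (0≤q-p u≤1)) (solve 1 (λ u → u :* u :+ u :* (con 1ℚ :- u) := u) refl u)) u≤1-½ε)
  where
  u≤1-½ε : u ℚ.≤ 1ℚ ℚ.- ½ ℚ.* ε
  u≤1-½ε = ≤-cert (+-nonNeg (0≤q-p l+ε≤1) (0≤q-p gap))
    (solve 3 (λ u l ε → u :+ ((con 1ℚ :- (l :+ ε)) :+ (con ½ :* ε :- (u :- l))) := con 1ℚ :- con ½ :* ε) refl u l ε)
  u≤1 : u ℚ.≤ 1ℚ
  u≤1 = ℚₚ.≤-trans u≤1-½ε (≤-cert (ℚₚ.<⇒≤ (half-pos 0<ε)) (solve 1 (λ e → con 1ℚ :- e :+ e := con 1ℚ) refl (½ ℚ.* ε)))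

sqrt<1 : ∀ {a B ε} n → 0ℚ ℚ.≤ B → 0ℚ ℚ.< ε → proj₁ (bisect (0ℚ ℚ.⊔ a) n) ℚ.+ ε ℚ.≤ 1ℚ →
         ℚ.∣ a ∣ ℚ.< B → (1ℚ ℚ.+ B) ℚ.* halves n ℚ.≤ ½ ℚ.* ε → a ℚ.≤ 1ℚ ℚ.- ½ ℚ.* ε
sqrt<1 {a} {B} {ε} n 0≤B 0<ε l+ε≤1 ∣a∣<B small
  with bisect (0ℚ ℚ.⊔ a) n | bisect-bracket (0ℚ ℚ.⊔ a) (ℚₚ.p≤p⊔q 0ℚ a) n
... | l , u | bracket 0≤l l≤u _ a<u² gap = bracket<1 (ℚₚ.≤-trans 0≤l l≤u)
  (ℚₚ.≤-trans (ℚₚ.p≤q⊔p 0ℚ a) (ℚₚ.<⇒≤ a<u²))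
  (ℚₚ.≤-trans (ℚₚ.≤-reflexive gap) (ℚₚ.≤-trans
    (ℚₚ.*-monoʳ-≤-nonNeg (halves n) {{ℚ.nonNegative (ℚₚ.<⇒≤ (halves-pos n))}}
      (ℚₚ.+-monoʳ-≤ 1ℚ (ℚₚ.⊔-lub 0≤B (∣p∣≤⇒p≤ (ℚₚ.<⇒≤ ∣a∣<B))))) small))
  l+ε≤1 0<ε

‖‖<1 : ∀ (v : Point d) → ‖ v ‖ < 1ℝ → ∃ λ ε → 0ℚ ℚ.< ε × Eventually (λ n → norm² (at v n) ℚ.≤ 1ℚ ℚ.- ε)
‖‖<1 v (ε , 0<ε , v<1) = ½ ℚ.* ε , half-pos 0<ε , mapᵉ norm²≤ ((v<1 ⊓ᵉ S<B) ⊓ᵉ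
  halves→0 (1ℚ ℚ.+ B) (½ ℚ.* ε) (ℚₚ.+-mono-< {0ℚ} {1ℚ} {0ℚ} (ℚₚ.positive⁻¹ 1ℚ) 0<B) (half-pos 0<ε))
  where
  S = foldr _+_ 0ℝ (λ i → v i * v i)
  B = proj₁ (bounded S)
  0<B = proj₁ (proj₂ (bounded S))
  S<B = proj₂ (proj₂ (bounded S))
  norm²≤ : ∀ {n} → (√-seq (seq S) n ℚ.+ ε ℚ.< 1ℚ × ℚ.∣ seq S n ∣ ℚ.< B) × (1ℚ ℚ.+ B) ℚ.* halves n ℚ.< ½ ℚ.* ε →
           norm² (at v n) ℚ.≤ 1ℚ ℚ.- ½ ℚ.* ε
  norm²≤ {n} ((l+ε<1 , ∣S∣<B) , small) = subst (ℚ._≤ 1ℚ ℚ.- ½ ℚ.* ε) (seq-norm² v n)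
    (sqrt<1 {seq S n} n (ℚₚ.<⇒≤ 0<B) 0<ε (ℚₚ.<⇒≤ l+ε<1) ∣S∣<B (ℚₚ.<⇒≤ small))

-- One late term decides. If it is below `q` by more than ε/2, all later terms are below `q` by a
-- margin of ε/4; otherwise they are at least q - 3ε/4.
≮⇒≥ : ∀ x q → ¬ (x < fromℚ q) → fromℚ q ≤ x
≮⇒≥ x q x≮q ε 0<ε with cauchy x (½ ℚ.* (½ ℚ.* ε)) (half-pos (half-pos 0<ε))
... | N , close with seq x N ℚ.+ (½ ℚ.* ε) ℚₚ.<? q
...   | yes xN<q = contradiction (e , half-pos (half-pos 0<ε) , N , λ n N≤n → ℚₚ.≤-<-trans
          (≤-cert (0≤q-p (∣p∣≤⇒p≤ (ℚₚ.<⇒≤ (close n N N≤n ℕₚ.≤-refl))))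
            (solve 3 (λ x y ε → x :+ con ½ :* (con ½ :* ε) :+ (con ½ :* (con ½ :* ε) :- (x :- y)) := y :+ con ½ :* ε)
              refl (seq x n) (seq x N) ε)) xN<q) x≮q
  where e = ½ ℚ.* (½ ℚ.* ε)
...   | no xN≮q = N , λ n N≤n → ℚₚ.≤-<-trans
          (≤-cert (+-nonNeg (0≤q-p (ℚₚ.≮⇒≥ xN≮q)) (0≤q-p (∣p∣≤⇒p≤ (ℚₚ.<⇒≤ (close N n ℕₚ.≤-refl N≤n)))))
            (solve 4 (λ x y ε q → q :+ (((y :+ con ½ :* ε) :- q) :+ (con ½ :* (con ½ :* ε) :- (y :- x)))
                := x :+ (con ½ :* ε :+ con ½ :* (con ½ :* ε))) refl (seq x n) (seq x N) ε q))
          (ℚₚ.+-monoʳ-< (seq x n) (subst (½ ℚ.* ε ℚ.+ ½ ℚ.* (½ ℚ.* ε) ℚ.<_) (half+half ε)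
            (ℚₚ.+-monoʳ-< (½ ℚ.* ε) (subst (½ ℚ.* (½ ℚ.* ε) ℚ.<_) (half+half (½ ℚ.* ε))
              (subst (ℚ._< ½ ℚ.* (½ ℚ.* ε) ℚ.+ ½ ℚ.* (½ ℚ.* ε)) (ℚₚ.+-identityʳ (½ ℚ.* (½ ℚ.* ε)))
                (ℚₚ.+-monoʳ-< (½ ℚ.* (½ ℚ.* ε)) (half-pos (half-pos 0<ε))))))))

-- The dimensional constant with ‖a‖² ≤ 2 and |b - a| ≤ Δ ≤ 1 coordinatewise
-- implying ‖b‖² ≤ ‖a‖² + κ Δ.
κ : ℕ → ℚ
κ d = 2ℚ ℚ.+ (R.fromℕ d ℚ.+ R.fromℕ d)

norm²-perturb-κ : ∀ {Δ} {a b : Vector ℚ d} → 0ℚ ℚ.≤ Δ → Δ ℚ.≤ 1ℚ → norm² a ℚ.≤ 2ℚ →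
                  Close Δ b a → norm² b ℚ.≤ norm² a ℚ.+ κ d ℚ.* Δ
norm²-perturb-κ {d} {Δ} {a} {b} 0≤Δ Δ≤1 a≤2 close = ℚₚ.≤-trans (norm²-perturb {a = a} {b} 0≤Δ Δ≤1 close)
  (≤-cert (*-nonNeg 0≤Δ (0≤q-p a≤2))
    (solve 3 (λ Δ A n → ((con 1ℚ :+ Δ) :* A :+ n :* (Δ :+ Δ)) :+ Δ :* (con 1ℚ :+ con 1ℚ :- A)
      := A :+ (con 1ℚ :+ con 1ℚ :+ (n :+ n)) :* Δ) refl Δ (norm² a) (R.fromℕ d)))

2≤κ : ∀ d → 2ℚ ℚ.≤ κ d
2≤κ d = ≤-cert (+-nonNeg {R.fromℕ d} {R.fromℕ d} (R.fromℕ-mono ℕ.z≤n) (R.fromℕ-mono ℕ.z≤n)) refl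

0<κ : ∀ d → 0ℚ ℚ.< κ d
0<κ d = ℚₚ.<-≤-trans (ℚₚ.positive⁻¹ 2ℚ) (2≤κ d)

-- `ε` is a budget for squared distances, and an error `δ` in each coordinate costs `κ d * δ`. The
-- bound ½ lets the errors at both ends of a step add up to at most 1, as `norm²-perturb-κ`
-- requires.
record Approximates (P : Point d) (p : Vector ℚ d) (ε : ℚ) : Set where
  constructor approximates
  field
    δ     : ℚ
    0≤δ   : 0ℚ ℚ.≤ δ
    δ≤½   : δ ℚ.≤ ½
    κδ≤ε  : κ d ℚ.* δ ℚ.≤ ε
    close : Eventually (λ n → Close δ (at P n) p)

embed : Vector ℚ d → Point d
embed p k = fromℚ (p k)

embed-approximates : ∀ (p : Vector ℚ d) → Approximates (embed p) p 0ℚ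
embed-approximates {d} p = approximates 0ℚ ℚₚ.≤-refl (ℚₚ.nonNegative⁻¹ ½) (ℚₚ.≤-reflexive (ℚₚ.*-zeroʳ (κ d)))
  (0 , λ _ _ k → ℚₚ.≤-reflexive (cong ℚ.∣_∣ (ℚₚ.+-inverseʳ (p k))))

step≤√2 : ∀ {P Q : Point d} {p q ε ε′} (s : Vector ℚ d) → Approximates P p ε → Approximates Q q ε′ →
          norm² (λ k → q k ℚ.- p k ℚ.- s k) ℚ.≤ 2ℚ ℚ.- (ε ℚ.+ ε′) →
          ‖ (Q ⊖ P) ⊖ embed s ‖ ≤ √ 2ℝ
step≤√2 {d} {P} {Q} {p} {q} {ε} {ε′} s AP AQ h = ‖‖≤√2 ((Q ⊖ P) ⊖ embed s) (mapᵉ bound (AP.close ⊓ᵉ AQ.close))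
  where
  module AP = Approximates AP
  module AQ = Approximates AQ
  a = λ k → q k ℚ.- p k ℚ.- s k
  Δ = AP.δ ℚ.+ AQ.δ
  0≤Δ = +-nonNeg AP.0≤δ AQ.0≤δ
  κΔ≤ : κ d ℚ.* Δ ℚ.≤ ε ℚ.+ ε′
  κΔ≤ = subst (ℚ._≤ ε ℚ.+ ε′) (sym (ℚₚ.*-distribˡ-+ (κ d) AP.δ AQ.δ)) (ℚₚ.+-mono-≤ AP.κδ≤ε AQ.κδ≤ε)
  a≤2 : norm² a ℚ.≤ 2ℚ
  a≤2 = ℚₚ.≤-trans h (≤-cert (ℚₚ.≤-trans (*-nonNeg (ℚₚ.<⇒≤ (0<κ d)) 0≤Δ) κΔ≤)
    (solve 1 (λ e → con 1ℚ :+ con 1ℚ :- e :+ e := con 1ℚ :+ con 1ℚ) refl (ε ℚ.+ ε′)))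
  bound : ∀ {n} → Close AP.δ (at P n) p × Close AQ.δ (at Q n) q →
          norm² (at ((Q ⊖ P) ⊖ embed s) n) ℚ.≤ 2ℚ
  bound {n} (P≈p , Q≈q) = ℚₚ.≤-trans
    (norm²-perturb-κ {a = a} {at ((Q ⊖ P) ⊖ embed s) n} 0≤Δ (ℚₚ.+-mono-≤ AP.δ≤½ AQ.δ≤½) a≤2 diff)
    (≤-cert (+-nonNeg (0≤q-p h) (0≤q-p κΔ≤))
      (solve 3 (λ A e κΔ → A :+ κΔ :+ (((con 1ℚ :+ con 1ℚ :- e) :- A) :+ (e :- κΔ)) := con 1ℚ :+ con 1ℚ)
        refl (norm² a) (ε ℚ.+ ε′) (κ d ℚ.* Δ)))
    where
    diff : Close Δ (at ((Q ⊖ P) ⊖ embed s) n) a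
    diff k = ∣p∣≤q
      (≤-cert (+-nonNeg (0≤q-p (∣p∣≤⇒p≤ (Q≈q k))) (0≤q-p (∣p∣≤⇒-p≤ (P≈p k))))
        (solve 7 (λ P p Q q s δ δ′ → (((Q :- P) :- s) :- ((q :- p) :- s)) :+ ((δ′ :- (Q :- q)) :+ (δ :- (:- (P :- p)))) := δ :+ δ′)
          refl (seq (P k) n) (p k) (seq (Q k) n) (q k) (s k) AP.δ AQ.δ))
      (≤-cert (+-nonNeg (0≤q-p (∣p∣≤⇒-p≤ (Q≈q k))) (0≤q-p (∣p∣≤⇒p≤ (P≈p k))))
        (solve 7 (λ P p Q q s δ δ′ → (:- (((Q :- P) :- s) :- ((q :- p) :- s))) :+ ((δ′ :- (:- (Q :- q))) :+ (δ :- (P :- p))) := δ :+ δ′)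
          refl (seq (P k) n) (p k) (seq (Q k) n) (q k) (s k) AP.δ AQ.δ))

-- Compactness

½≤1 : ½ ℚ.≤ 1ℚ
½≤1 = ≤-cert (ℚₚ.nonNegative⁻¹ ½) refl

module _ (em : ExcludedMiddle 0ℓ) where

  -- If no member were that near, 1 would be a lower bound of the distances, hence at most their
  -- infimum, which is below 1.
  nearby : ∀ (X : Subset d) → OneDense X → ∀ y → ∃ λ x → x ∈ X × ‖ y ⊖ x ‖ < 1ℝ
  nearby X dense y = found em
    where
    found : Dec (∃ λ x → x ∈ X × ‖ y ⊖ x ‖ < 1ℝ) → ∃ λ x → x ∈ X × ‖ y ⊖ x ‖ < 1ℝ
    found (yes p) = p
    found (no ¬p) =
      let δ , (_ , greatest) , ε , 0<ε , M , δ<1 = dense y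
          N , 1<δ = greatest 1ℝ (λ x x∈X → ≮⇒≥ ‖ y ⊖ x ‖ 1ℚ (λ lt → ¬p (x , x∈X , lt))) ε 0<ε
      in contradiction (ℚₚ.<-trans (1<δ (M ℕ.⊔ N) (ℕₚ.m≤n⊔m M N)) (δ<1 (M ℕ.⊔ N) (ℕₚ.m≤m⊔n M N)))
           (ℚₚ.<-irrefl refl)

-- One `slack` serves twice: as the error budget of the approximation and as the margin kept inside
-- the unit ball, so replacing `approx` by `point` is paid for in advance.
record Sample (X : Subset d) : Set where
  field
    point        : Point d
    point∈X      : point ∈ X
    approx       : Vector ℚ d
    slack        : ℚ
    slack>0      : 0ℚ ℚ.< slack
    point≈approx : Approximates point approx slack

module Samples {d} {X : Subset d} = Blending {S = Sample X} Sample.approx Sample.slack Sample.slack>0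
open Samples

Covers : (X : Subset d) → ℚ → Vector ℚ d → List (Sample X) → Set
Covers X r z L = ∀ c → Close r c z → Any (Core c) L

Coverable : (X : Subset d) → ℚ → Vector ℚ d → Set
Coverable X r z = ∃ (Covers X r z)

concatAll : ∀ {A : Set} → (Vec Bool d → List A) → List A
concatAll {zero}  f = f []
concatAll {suc d} f = concatAll (f ∘ (true ∷_)) ++ concatAll (f ∘ (false ∷_))

concatAll⁺ : ∀ {A : Set} {P : A → Set} (f : Vec Bool d → List A) σ → Any P (f σ) → Any P (concatAll f)
concatAll⁺ f []          p = p
concatAll⁺ f (true  ∷ σ) p = Any.++⁺ˡ (concatAll⁺ (f ∘ (true ∷_)) σ p)
concatAll⁺ f (false ∷ σ) p = Any.++⁺ʳ (concatAll (f ∘ (true ∷_))) (concatAll⁺ (f ∘ (false ∷_)) σ p)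

subcentre : Vector ℚ d → ℚ → Vec Bool d → Vector ℚ d
subcentre z r σ k = if lookup σ k then z k ℚ.+ r else z k ℚ.- r

subcentre-close : ∀ (z : Vector ℚ d) {r} σ → 0ℚ ℚ.≤ r → Close r (subcentre z r σ) z
subcentre-close z {r} σ 0≤r k with lookup σ k
... | true  = ∣p∣≤q (ℚₚ.≤-reflexive (solve 2 (λ z r → z :+ r :- z := r) refl (z k) r))
  (≤-cert (+-nonNeg 0≤r 0≤r) (solve 2 (λ z r → (:- (z :+ r :- z)) :+ (r :+ r) := r) refl (z k) r))
... | false = ∣p∣≤q (≤-cert (+-nonNeg 0≤r 0≤r) (solve 2 (λ z r → (z :- r :- z) :+ (r :+ r) := r) refl (z k) r))
  (ℚₚ.≤-reflexive (solve 2 (λ z r → :- (z :- r :- z) := r) refl (z k) r))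

octant : Vector ℚ d → Vector ℚ d → Vec Bool d
octant z c = Vec.tabulate (λ k → does (z k ℚₚ.≤? c k))

half-close : ∀ {c z r} (z≤?c : Dec (z ℚ.≤ c)) → ℚ.∣ c ℚ.- z ∣ ℚ.≤ r ℚ.+ r →
             ℚ.∣ c ℚ.- (if does z≤?c then z ℚ.+ r else z ℚ.- r) ∣ ℚ.≤ r
half-close {c} {z} {r} (yes z≤c) c≈z = ∣p∣≤q
  (≤-cert (0≤q-p (∣p∣≤⇒p≤ c≈z)) (solve 3 (λ c z r → (c :- (z :+ r)) :+ (r :+ r :- (c :- z)) := r) refl c z r))
  (≤-cert (0≤q-p z≤c) (solve 3 (λ c z r → (:- (c :- (z :+ r))) :+ (c :- z) := r) refl c z r))
half-close {c} {z} {r} (no z≰c) c≈z = ∣p∣≤q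
  (≤-cert (0≤q-p (ℚₚ.<⇒≤ (ℚₚ.≰⇒> z≰c))) (solve 3 (λ c z r → (c :- (z :- r)) :+ (z :- c) := r) refl c z r))
  (≤-cert (0≤q-p (∣p∣≤⇒-p≤ c≈z)) (solve 3 (λ c z r → (:- (c :- (z :- r))) :+ (r :+ r :- (:- (c :- z))) := r) refl c z r))

octant-close : ∀ {z c : Vector ℚ d} {r} → Close (r ℚ.+ r) c z → Close r c (subcentre z r (octant z c))
octant-close {z = z} {c} {r} c≈z k = subst (λ b → ℚ.∣ c k ℚ.- (if b then z k ℚ.+ r else z k ℚ.- r) ∣ ℚ.≤ r)
  (sym (lookup∘tabulate (λ k → does (z k ℚₚ.≤? c k)) k)) (half-close (z k ℚₚ.≤? c k) (c≈z k))

coverable-split : ∀ {X : Subset d} {r z} → (∀ σ → Coverable X r (subcentre z r σ)) → Coverable X (r ℚ.+ r) z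
coverable-split {z = z} sub = concatAll (proj₁ ∘ sub) , λ c c≈z →
  concatAll⁺ (proj₁ ∘ sub) (octant z c) (proj₂ (sub (octant z c)) c (octant-close {z = z} {c} c≈z))

-- Heine–Borel by bisection: the centres of nested boxes that no finite list
-- covers converge to a point, and a single sample near that point covers a
-- small box around it.
module HeineBorel (em : ExcludedMiddle 0ℓ) {X : Subset d} (dense : OneDense X) {R} (0<R : 0ℚ ℚ.< R) where

  radius : ℕ → ℚ
  radius m = R ℚ.* halves m

  0≤radius : ∀ m → 0ℚ ℚ.≤ radius m
  0≤radius m = *-nonNeg (ℚₚ.<⇒≤ 0<R) (ℚₚ.<⇒≤ (halves-pos m))

  radius-halves : ∀ m → radius (suc m) ℚ.+ radius (suc m) ≡ radius m
  radius-halves m = solve 2 (λ R h → R :* (con ½ :* h) :+ R :* (con ½ :* h) := R :* h) refl R (halves m)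

  Bad : ℕ → Vector ℚ d → Set
  Bad m z = ¬ Coverable X (radius m) z

  bad-split : ∀ m z → Bad m z → ∃ λ σ → Bad (suc m) (subcentre z (radius (suc m)) σ)
  bad-split m z bad = found em
    where
    found : Dec _ → ∃ λ σ → Bad (suc m) (subcentre z (radius (suc m)) σ)
    found (yes p) = p
    found (no ¬p) = contradiction (subst (λ r → Coverable X r z) (radius-halves m)
      (coverable-split (λ σ → covered σ em))) bad
      where
      covered : ∀ σ → Dec (Coverable X (radius (suc m)) (subcentre z (radius (suc m)) σ)) → _
      covered σ (yes c) = c
      covered σ (no ¬c) = contradiction (σ , ¬c) ¬p

  module Nested (z₀ : Vector ℚ d) (bad₀ : Bad 0 z₀) where

    nest : ∀ m → ∃ (Bad m)
    nest zero    = z₀ , bad₀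
    nest (suc m) =
      let z , bad = nest m ; σ , bad′ = bad-split m z bad in subcentre z (radius (suc m)) σ , bad′

    z : ℕ → Vector ℚ d
    z m = proj₁ (nest m)

    z-step : ∀ m → Close (radius (suc m)) (z (suc m)) (z m)
    z-step m = subcentre-close (z m) (proj₁ (bad-split m (z m) (proj₂ (nest m)))) (0≤radius (suc m))

    -- Subtracting the current radius makes the induction close, since each step uses up exactly
    -- half of it.
    z-tail : ∀ m j → Close (radius m ℚ.- radius (j ℕ.+ m)) (z (j ℕ.+ m)) (z m)
    z-tail m zero    k = ℚₚ.≤-reflexive (trans (cong ℚ.∣_∣ (ℚₚ.+-inverseʳ (z m k))) (sym (ℚₚ.+-inverseʳ (radius m))))
    z-tail m (suc j) k = ℚₚ.≤-trans (∣∣-triangle (z (suc j ℕ.+ m) k) (z (j ℕ.+ m) k) (z m k))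
      (ℚₚ.≤-trans (ℚₚ.+-mono-≤ (z-step (j ℕ.+ m) k) (z-tail m j k)) (ℚₚ.≤-reflexive
        (trans (cong (λ t → radius (suc j ℕ.+ m) ℚ.+ (radius m ℚ.- t)) (sym (radius-halves (j ℕ.+ m))))
          (solve 2 (λ s r → s :+ (r :- (s :+ s)) := r :- s) refl (radius (suc j ℕ.+ m)) (radius m)))))

    z-close : ∀ m n → m ℕ.≤ n → Close (radius m) (z n) (z m)
    z-close m n m≤n k = subst (λ n → ℚ.∣ z n k ℚ.- z m k ∣ ℚ.≤ radius m) (ℕₚ.m∸n+n≡m m≤n)
      (ℚₚ.≤-trans (z-tail m (n ℕ.∸ m) k) (≤-cert (0≤radius ((n ℕ.∸ m) ℕ.+ m))
        (solve 2 (λ a b → a :- b :+ b := a) refl (radius m) (radius ((n ℕ.∸ m) ℕ.+ m)))))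

    limit : Point d
    limit k = real (λ n → z n k) λ ε 0<ε →
      let N , small = halves→0 (R ℚ.+ R) ε (ℚₚ.+-mono-< {0ℚ} {R} {0ℚ} 0<R 0<R) 0<ε
      in N , λ m n N≤m N≤n → ℚₚ.≤-<-trans (∣∣-triangle (z m k) (z N k) (z n k))
        (ℚₚ.≤-<-trans (ℚₚ.+-mono-≤ (z-close N m N≤m k) (subst (ℚ._≤ radius N) (∣p-q∣≡∣q-p∣ (z n k) (z N k)) (z-close N n N≤n k)))
          (subst (ℚ._< ε) (ℚₚ.*-distribʳ-+ (halves N) R R) (small N ℕₚ.≤-refl)))

    module Local {x} (x∈X : x ∈ X) {e} (0<e : 0ℚ ℚ.< e)
                 (near : Eventually (λ n → norm² (at (limit ⊖ x) n) ℚ.≤ 1ℚ ℚ.- e)) where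

      -- A quarter of `e`: the bound 1 - e = 1 - 4s plus a perturbation cost of s stays below the 1
      -- - 2s that `Core` asks for.
      s : ℚ
      s = ½ ℚ.* (½ ℚ.* e)

      0<s : 0ℚ ℚ.< s
      0<s = half-pos (half-pos 0<e)

      δ : ℚ
      δ = proj₁ (quotient s (κ d) 0<s (0<κ d))

      0<δ : 0ℚ ℚ.< δ
      0<δ = proj₁ (proj₂ (quotient s (κ d) 0<s (0<κ d)))

      κδ≡s : κ d ℚ.* δ ≡ s
      κδ≡s = proj₂ (proj₂ (quotient s (κ d) 0<s (0<κ d)))

      settled : Eventually (λ n → ∀ k m → n ℕ.≤ m → ℚ.∣ seq (x k) m ℚ.- seq (x k) n ∣ ℚ.≤ δ)
      settled = allᵉ λ k → let N , close = cauchy (x k) δ 0<δ in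
        N , λ n N≤n m n≤m → ℚₚ.<⇒≤ (close m n (ℕₚ.≤-trans N≤n n≤m) N≤n)

      -- A single stage must serve all three purposes: the N-th term of `limit` is the centre `z N`
      -- of the N-th box, so nearness of `limit` to `x` at stage N speaks about that very box.
      stage : Eventually (λ n → (norm² (at (limit ⊖ x) n) ℚ.≤ 1ℚ ℚ.- e × radius n ℚ.< δ) ×
                                (∀ k m → n ℕ.≤ m → ℚ.∣ seq (x k) m ℚ.- seq (x k) n ∣ ℚ.≤ δ))
      stage = (near ⊓ᵉ halves→0 R δ 0<R 0<δ) ⊓ᵉ settled

      N : ℕ
      N = proj₁ stage

      at-N = proj₂ stage N ℕₚ.≤-refl
      near-N = proj₁ (proj₁ at-N)

      e≤1 : e ℚ.≤ 1ℚ
      e≤1 = ≤-cert (ℚₚ.≤-trans (norm²-nonNeg (at (limit ⊖ x) N)) near-N)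
        (solve 1 (λ e → e :+ (con 1ℚ :- e) := con 1ℚ) refl e)

      δ≤½ : δ ℚ.≤ ½
      δ≤½ = ≤-cert (*-nonNeg (ℚₚ.nonNegative⁻¹ ½) (+-nonNeg (+-nonNeg 0≤1-s
              (ℚₚ.≤-reflexive (sym (ℚₚ.+-inverseʳ s))))
              (*-nonNeg (ℚₚ.<⇒≤ 0<δ) (0≤q-p (2≤κ d)))))
        (trans (cong (λ t → δ ℚ.+ ½ ℚ.* ((1ℚ ℚ.- s) ℚ.+ (s ℚ.- t) ℚ.+ δ ℚ.* (κ d ℚ.- 2ℚ))) (sym κδ≡s))
          (solve 3 (λ δ s κ → δ :+ con ½ :* ((con 1ℚ :- s) :+ (s :- κ :* δ) :+ δ :* (κ :- (con 1ℚ :+ con 1ℚ))) := con ½)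
            refl δ s (κ d)))
        where
        0≤1-s : 0ℚ ℚ.≤ 1ℚ ℚ.- s
        0≤1-s = ℚₚ.≤-trans (+-nonNeg (0≤q-p e≤1) (ℚₚ.<⇒≤ (¾-pos 0<e))) (ℚₚ.≤-reflexive
          (solve 1 (λ e → (con 1ℚ :- e) :+ (con ½ :* e :+ con ½ :* (con ½ :* e)) := con 1ℚ :- con ½ :* (con ½ :* e)) refl e))
          where
          ¾-pos : ∀ {e} → 0ℚ ℚ.< e → 0ℚ ℚ.< ½ ℚ.* e ℚ.+ ½ ℚ.* (½ ℚ.* e)
          ¾-pos {e} 0<e = ℚₚ.+-mono-< {0ℚ} {½ ℚ.* e} {0ℚ} (half-pos 0<e) (half-pos (half-pos 0<e))

      sample : Sample X
      sample = record
        { point        = x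
        ; point∈X      = x∈X
        ; approx       = at x N
        ; slack        = s
        ; slack>0      = 0<s
        ; point≈approx = approximates δ (ℚₚ.<⇒≤ 0<δ) δ≤½ (ℚₚ.≤-reflexive κδ≡s)
                           (N , λ n N≤n k → proj₂ at-N k n N≤n)
        }

      covers : Covers X (radius N) (z N) (sample ∷ [])
      covers c c≈z = here (ℚₚ.≤-trans
        (norm²-perturb-κ {a = at (limit ⊖ x) N} {λ k → c k ℚ.- seq (x k) N} (ℚₚ.<⇒≤ 0<δ)
          (ℚₚ.≤-trans δ≤½ ½≤1) a≤2 close)
        (≤-cert (+-nonNeg (0≤q-p near-N) (ℚₚ.<⇒≤ 0<s))
          (trans (cong (λ t → norm² (at (limit ⊖ x) N) ℚ.+ t ℚ.+ ((1ℚ ℚ.- e ℚ.- norm² (at (limit ⊖ x) N)) ℚ.+ s)) κδ≡s)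
            (solve 2 (λ A e → A :+ con ½ :* (con ½ :* e) :+ ((con 1ℚ :- e :- A) :+ con ½ :* (con ½ :* e))
              := con 1ℚ :- (con ½ :* (con ½ :* e) :+ con ½ :* (con ½ :* e))) refl (norm² (at (limit ⊖ x) N)) e))))
        where
        a≤2 : norm² (at (limit ⊖ x) N) ℚ.≤ 2ℚ
        a≤2 = ℚₚ.≤-trans near-N (≤-cert (+-nonNeg (ℚₚ.<⇒≤ 0<e) 0≤1)
          (solve 1 (λ e → con 1ℚ :- e :+ (e :+ con 1ℚ) := con 1ℚ :+ con 1ℚ) refl e))
        close : Close δ (λ k → c k ℚ.- seq (x k) N) (at (limit ⊖ x) N)
        close k = subst (λ t → ℚ.∣ t ∣ ℚ.≤ δ)
          (solve 3 (λ c z x → c :- z := (c :- x) :- (z :- x)) refl (c k) (z N k) (seq (x k) N))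
          (ℚₚ.≤-trans (c≈z k) (ℚₚ.<⇒≤ (proj₂ (proj₁ at-N))))

    impossible : ⊥
    impossible = 
      let x , x∈X , near = nearby em X dense limit
          e , 0<e , near′ = ‖‖<1 (limit ⊖ x) near
          open Local x∈X 0<e near′
      in proj₂ (nest N) (sample ∷ [] , covers)

  coverable : ∀ z → Coverable X R z
  coverable z = found em
    where
    found : Dec (Coverable X R z) → Coverable X R z
    found (yes c) = c
    found (no ¬c) = ⊥-elim (Nested.impossible z (subst (λ r → ¬ Coverable X r z) (sym (ℚₚ.*-identityʳ R)) ¬c))

-- The path

Samplings : (Fin n → Subset d) → Set
Samplings X = ∀ i → List (Sample (X i))

-- The position of p₀ predicted from pₙ = 0 and the step s, walking backwards
-- and replacing every point by the centre of the samples around its prediction.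
predict : ∀ n {X : Fin n → Subset d} → Samplings X → Vector ℚ d → Vector ℚ d
predict zero    L s k = ℚ.- s k
predict (suc n) L s k = centre (L zero) (predict n (L ∘ suc) s) k ℚ.- s k

-- A drift of at most `n` plus `1 + n` steps with coordinates at most 1: the box that contains all
-- predictions and has to be covered.
reach : ℕ → ℚ
reach n = R.fromℕ n ℚ.+ (1ℚ ℚ.+ R.fromℕ n)

0≤fromℕ : ∀ n → 0ℚ ℚ.≤ R.fromℕ n
0≤fromℕ n = R.fromℕ-mono {0} {n} ℕ.z≤n

0≤reach : ∀ n → 0ℚ ℚ.≤ reach n
0≤reach n = +-nonNeg (0≤fromℕ n) (+-nonNeg 0≤1 (0≤fromℕ n))

reach-suc : ∀ n → reach n ℚ.≤ reach (suc n)
reach-suc n = ℚₚ.+-mono-≤ n≤1+n (ℚₚ.+-monoʳ-≤ 1ℚ n≤1+n)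
  where n≤1+n = R.fromℕ-mono (ℕₚ.n≤1+n n)

CoversBox : ℚ → {X : Fin n → Subset d} → Samplings X → Set
CoversBox R L = ∀ i c → Box R c → Any (Core c) (L i)

module _ {R : ℚ} where

  -- Mutual with `predict-box`: the drift bound needs the later prediction inside the covered box,
  -- and that in turn follows from its drift bound.
  predict-drift : ∀ n {X : Fin n → Subset d} (L : Samplings X) → CoversBox R L → reach n ℚ.≤ R → ∀ {s} → Box 1ℚ s →
                  ∀ k → ℚ.∣ predict n L s k ℚ.+ (1ℚ ℚ.+ R.fromℕ n) ℚ.* s k ∣ ℚ.≤ R.fromℕ n
  predict-box   : ∀ n {X : Fin n → Subset d} (L : Samplings X) → CoversBox R L → reach n ℚ.≤ R → ∀ {s} → Box 1ℚ s →
                  Box R (predict n L s)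

  predict-drift zero    L cov reach≤R {s} s≤1 k = ℚₚ.≤-reflexive
    (cong ℚ.∣_∣ (solve 1 (λ s → (:- s) :+ (con 1ℚ :+ con 0ℚ) :* s := con 0ℚ) refl (s k)))
  predict-drift (suc n) L cov reach≤R {s} s≤1 k = begin
    ℚ.∣ (m ℚ.- s k) ℚ.+ (1ℚ ℚ.+ R.fromℕ (suc n)) ℚ.* s k ∣
      ≡⟨ cong (λ t → ℚ.∣ (m ℚ.- s k) ℚ.+ (1ℚ ℚ.+ t) ℚ.* s k ∣) (R.fromℕ-suc n) ⟩
    ℚ.∣ (m ℚ.- s k) ℚ.+ (1ℚ ℚ.+ (1ℚ ℚ.+ R.fromℕ n)) ℚ.* s k ∣
      ≡⟨ cong ℚ.∣_∣ (solve 4 (λ m s n c → (m :- s) :+ (con 1ℚ :+ (con 1ℚ :+ n)) :* s := (m :- c) :+ (c :+ (con 1ℚ :+ n) :* s))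
           refl m (s k) (R.fromℕ n) (c k)) ⟩
    ℚ.∣ (m ℚ.- c k) ℚ.+ (c k ℚ.+ (1ℚ ℚ.+ R.fromℕ n) ℚ.* s k) ∣
      ≤⟨ ℚₚ.∣p+q∣≤∣p∣+∣q∣ (m ℚ.- c k) (c k ℚ.+ (1ℚ ℚ.+ R.fromℕ n) ℚ.* s k) ⟩
    ℚ.∣ m ℚ.- c k ∣ ℚ.+ ℚ.∣ c k ℚ.+ (1ℚ ℚ.+ R.fromℕ n) ℚ.* s k ∣
      ≤⟨ ℚₚ.+-mono-≤ (centre-near c (L zero) (cov zero c (predict-box n (L ∘ suc) (cov ∘ suc) reach≤R′ s≤1)) k)
                     (predict-drift n (L ∘ suc) (cov ∘ suc) reach≤R′ s≤1 k) ⟩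
    1ℚ ℚ.+ R.fromℕ n
      ≡⟨ sym (R.fromℕ-suc n) ⟩
    R.fromℕ (suc n) ∎
    where
    open ℚₚ.≤-Reasoning
    reach≤R′ = ℚₚ.≤-trans (reach-suc n) reach≤R
    c = predict n (L ∘ suc) s
    m = centre (L zero) c k

  predict-box n L cov reach≤R {s} s≤1 k = ℚₚ.≤-trans (begin
    ℚ.∣ predict n L s k ∣
      ≡⟨ cong ℚ.∣_∣ (solve 2 (λ c t → c := (c :+ t) :- t) refl (predict n L s k) (N ℚ.* s k)) ⟩
    ℚ.∣ (predict n L s k ℚ.+ N ℚ.* s k) ℚ.- N ℚ.* s k ∣
      ≤⟨ ℚₚ.∣p-q∣≤∣p∣+∣q∣ (predict n L s k ℚ.+ N ℚ.* s k) (N ℚ.* s k) ⟩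
    ℚ.∣ predict n L s k ℚ.+ N ℚ.* s k ∣ ℚ.+ ℚ.∣ N ℚ.* s k ∣
      ≤⟨ ℚₚ.+-mono-≤ (predict-drift n L cov reach≤R s≤1 k) (∣p*q∣≤ (ℚₚ.≤-reflexive (ℚₚ.0≤p⇒∣p∣≡p 0≤N)) (s≤1 k)) ⟩
    R.fromℕ n ℚ.+ N ℚ.* 1ℚ
      ≡⟨ cong (R.fromℕ n ℚ.+_) (ℚₚ.*-identityʳ N) ⟩
    reach n ∎) reach≤R
    where
    open ℚₚ.≤-Reasoning
    N = 1ℚ ℚ.+ R.fromℕ n
    0≤N = +-nonNeg 0≤1 (0≤fromℕ n)

  predict-lip : ∀ n {X : Fin n → Subset d} (L : Samplings X) → CoversBox R L → reach n ℚ.≤ R →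
                ∀ k → Lipschitz 1ℚ (λ s → predict n L s k)
  predict-lip zero    L cov reach≤R k = neg-lip (coord-lip 0≤1 k)
  predict-lip (suc n) L cov reach≤R k = -‿lip
    (∘-lip (centre-lip 0≤R (L zero) k) (predict-lip n (L ∘ suc) (cov ∘ suc) reach≤R′) (predict-box n (L ∘ suc) (cov ∘ suc) reach≤R′))
    (coord-lip 0≤1 k)
    where
    reach≤R′ = ℚₚ.≤-trans (reach-suc n) reach≤R
    0≤R = ℚₚ.≤-trans (0≤reach n) reach≤R′

  -- Averaging over the samples around the predicted position of p₁ yields one
  -- that is both close to its prediction and reachable from p₀.
  path : ∀ n {X : Fin n → Subset d} (L : Samplings X) → CoversBox R L → reach n ℚ.≤ R → ∀ {s} → Box 1ℚ s →
         (Step : Point d → Point d → Set) →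
         (∀ {P Q p q ε ε′} → Approximates P p ε → Approximates Q q ε′ →
           norm² (λ k → q k ℚ.- p k ℚ.- s k) ℚ.≤ 2ℚ ℚ.- (ε ℚ.+ ε′) → Step P Q) →
         ∀ {P p ε} → Approximates P p ε → dist² p (predict n L s) ℚ.≤ 1ℚ ℚ.- ε →
         ∃ λ (rest : Vector (Point d) (suc n)) →
           rest (fromℕ n) ≋ origin × (∀ i → rest (inject₁ i) ∈ X i) ×
           (∀ i → Step ((P Vector.∷ rest) (inject₁ i)) ((P Vector.∷ rest) (suc i)))
  path {d} zero L cov reach≤R {s} s≤1 Step step {P} {p} {ε} P≈p near = (λ _ → origin) , (λ k ε 0<ε → 0 , λ _ _ → 0<ε) , (λ ()) , steps
    where
    last-step : norm² (λ k → 0ℚ ℚ.- p k ℚ.- s k) ℚ.≤ 2ℚ ℚ.- (ε ℚ.+ 0ℚ)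
    -- The last prediction is `-s`, so nearness to it bounds the step to the origin, even by 1
    -- instead of 2.
    last-step = subst (ℚ._≤ 2ℚ ℚ.- (ε ℚ.+ 0ℚ))
      (∑-cong λ k → solve 2 (λ p s → (p :- (:- s)) :* (p :- (:- s)) := (con 0ℚ :- p :- s) :* (con 0ℚ :- p :- s)) refl (p k) (s k))
      (ℚₚ.≤-trans near (≤-cert 0≤1 (solve 1 (λ ε → con 1ℚ :- ε :+ con 1ℚ := con 1ℚ :+ con 1ℚ :- (ε :+ con 0ℚ)) refl ε)))
    steps : ∀ i → Step ((P Vector.∷ λ _ → origin) (inject₁ i)) origin
    steps zero = step {P} {origin} {p} {λ _ → 0ℚ} P≈p (embed-approximates (λ _ → 0ℚ)) last-step
  path {d} (suc n) {X} L cov reach≤R {s} s≤1 Step step {P} {p} {ε} P≈p near =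
    Q Vector.∷ rest , proj₁ (proj₂ tail) , members , steps
    where
    reach≤R′ = ℚₚ.≤-trans (reach-suc n) reach≤R
    c m z : Vector ℚ d
    c = predict n (L ∘ suc) s
    m = centre (L zero) c
    z k = p k ℚ.+ s k
    near′ : dist² z m ℚ.≤ 1ℚ ℚ.- ε
    near′ = subst (ℚ._≤ 1ℚ ℚ.- ε)
      (∑-cong λ k → solve 3 (λ p m s → (p :- (m :- s)) :* (p :- (m :- s)) := ((p :+ s) :- m) :* ((p :+ s) :- m)) refl (p k) (m k) (s k)) near
    chosen : ∃ λ σ → Inside c σ × dist² z (Sample.approx σ) ℚ.≤ 2ℚ ℚ.- (ε ℚ.+ Sample.slack σ)
    chosen = centre-step z c (L zero) {ε} (cov zero c (predict-box n (L ∘ suc) (cov ∘ suc) reach≤R′ s≤1)) near′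
    σ = proj₁ chosen
    y = Sample.approx σ
    Q = Sample.point σ
    tail : ∃ λ (rest : Vector (Point d) (suc n)) →
           rest (fromℕ n) ≋ origin × (∀ i → rest (inject₁ i) ∈ X (suc i)) × (∀ i → Step ((Q Vector.∷ rest) (inject₁ i)) ((Q Vector.∷ rest) (suc i)))
    -- `Inside c σ` is the nearness hypothesis for the next point, with the slack of `σ` as its
    -- error budget.
    tail = path n (L ∘ suc) (cov ∘ suc) reach≤R′ s≤1 Step step (Sample.point≈approx σ)
      (subst (ℚ._≤ 1ℚ ℚ.- Sample.slack σ) (dist²-sym c y) (proj₁ (proj₂ chosen)))
    rest = proj₁ tail
    members : ∀ i → (Q Vector.∷ rest) (inject₁ i) ∈ X i
    members zero    = Sample.point∈X σ
    members (suc i) = proj₁ (proj₂ (proj₂ tail)) i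
    first-step : norm² (λ k → y k ℚ.- p k ℚ.- s k) ℚ.≤ 2ℚ ℚ.- (ε ℚ.+ Sample.slack σ)
    first-step = subst (ℚ._≤ 2ℚ ℚ.- (ε ℚ.+ Sample.slack σ))
      (∑-cong λ k → solve 3 (λ p q s → ((p :+ s) :- q) :* ((p :+ s) :- q) := (q :- p :- s) :* (q :- p :- s)) refl (p k) (y k) (s k))
      (proj₂ (proj₂ chosen))
    steps : ∀ i → Step ((P Vector.∷ Q Vector.∷ rest) (inject₁ i)) ((Q Vector.∷ rest) i)
    steps zero    = step {P} {Q} {p} {y} P≈p (Sample.point≈approx σ) first-step
    steps (suc i) = proj₂ (proj₂ (proj₂ tail)) i

-- Solving for the step

fromℕ-+ : ∀ m n → R.fromℕ (m ℕ.+ n) ≡ R.fromℕ m ℚ.+ R.fromℕ n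
fromℕ-+ zero    n = sym (ℚₚ.+-identityˡ (R.fromℕ n))
fromℕ-+ (suc m) n = trans (R.fromℕ-suc (m ℕ.+ n)) (trans (cong (1ℚ ℚ.+_) (fromℕ-+ m n))
  (trans (sym (ℚₚ.+-assoc 1ℚ (R.fromℕ m) (R.fromℕ n))) (cong (ℚ._+ R.fromℕ n) (sym (R.fromℕ-suc m)))))

norm²-bound : ∀ {a : Vector ℚ d} {t} → (∀ k → ℚ.∣ a k ∣ ℚ.≤ t) → norm² a ℚ.≤ R.fromℕ d ℚ.* (t ℚ.* t)
norm²-bound {d} {a} {t} a≤t = ℚₚ.≤-trans
  (∑-mono {b = λ k → 0ℚ ℚ.* a k ℚ.+ t ℚ.* t} λ k → ℚₚ.≤-trans (∣p∣≤⇒p≤ (∣p*q∣≤ (a≤t k) (a≤t k)))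
    (ℚₚ.≤-reflexive (solve 2 (λ a t → t := con 0ℚ :* a :+ t) refl (a k) (t ℚ.* t))))
  (ℚₚ.≤-reflexive (trans (∑-affine 0ℚ (t ℚ.* t) a)
    (solve 2 (λ a t → con 0ℚ :* a :+ t := t) refl (∑ a) (R.fromℕ d ℚ.* (t ℚ.* t)))))

-- Poincaré–Miranda on a grid in [-1, 1]ᵈ that is fine enough for the Lipschitz constant K.
module Zero {f : Vector ℚ d → Vector ℚ d} (f-lip : ∀ k → Lipschitz 1ℚ (λ s → f s k))
            (f-pos : ∀ {s} → Box 1ℚ s → ∀ k → s k ≡ ℚ.- 1ℚ → 0ℚ ℚ.< f s k)
            (f-neg : ∀ {s} → Box 1ℚ s → ∀ k → s k ≡ 1ℚ → f s k ℚ.≤ 0ℚ) where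

  D K : ℚ
  D = R.fromℕ d
  K = ∑ (λ k → slope (f-lip k))

  0≤D = 0≤fromℕ d
  0≤K = ∑-nonNeg (λ k → 0≤slope (f-lip k))

  -- The mesh is 1/M with M above this constant, so that `(1 + D) * K * η ≤ 1` in `t-small`, where
  -- `η` is the length of `d` grid steps of size 2/M.
  enough : ∃ λ m → K ℚ.* (2ℚ ℚ.* D) ℚ.* (1ℚ ℚ.+ D) ℚ.≤ R.fromℕ m
  enough = archimedean (K ℚ.* (2ℚ ℚ.* D) ℚ.* (1ℚ ℚ.+ D))

  M : ℕ
  M = suc (proj₁ enough)

  mesh : ∃ λ ι → 0ℚ ℚ.< ι × R.fromℕ M ℚ.* ι ≡ 1ℚ
  mesh = quotient 1ℚ (R.fromℕ M) (ℚₚ.positive⁻¹ 1ℚ) (ℚₚ.positive⁻¹ (R.fromℕ M))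

  ι : ℚ
  ι = proj₁ mesh

  0≤ι : 0ℚ ℚ.≤ ι
  0≤ι = ℚₚ.<⇒≤ (proj₁ (proj₂ mesh))

  Mι≡1 : R.fromℕ M ℚ.* ι ≡ 1ℚ
  Mι≡1 = proj₂ (proj₂ mesh)

  -- Truncation at `M` keeps the nodes in the box for all lattice points, including those that the
  -- relation `≼` allows beyond the grid.
  node : ℕ → ℚ
  node i = ℚ.- 1ℚ ℚ.+ 2ℚ ℚ.* (R.fromℕ (i ℕ.⊓ M) ℚ.* ι)

  grid : Vec ℕ d → Vector ℚ d
  grid x k = node (lookup x k)

  ratio≤1 : ∀ i → R.fromℕ (i ℕ.⊓ M) ℚ.* ι ℚ.≤ 1ℚ
  ratio≤1 i = ℚₚ.≤-trans (ℚₚ.*-monoʳ-≤-nonNeg ι {{ℚ.nonNegative 0≤ι}} (R.fromℕ-mono (ℕₚ.m⊓n≤n i M))) (ℚₚ.≤-reflexive Mι≡1)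

  0≤2 : 0ℚ ℚ.≤ 2ℚ
  0≤2 = ℚₚ.nonNegative⁻¹ 2ℚ

  grid-box : ∀ x → Box 1ℚ (grid x)
  grid-box x k = ∣p∣≤q
    (≤-cert (*-nonNeg 0≤2 (0≤q-p (ratio≤1 i)))
      (solve 1 (λ t → (:- (con 1ℚ)) :+ (con 1ℚ :+ con 1ℚ) :* t :+ (con 1ℚ :+ con 1ℚ) :* (con 1ℚ :- t) := con 1ℚ) refl t))
    (≤-cert (*-nonNeg 0≤2 (*-nonNeg (0≤fromℕ (i ℕ.⊓ M)) 0≤ι))
      (solve 1 (λ t → :- ((:- (con 1ℚ)) :+ (con 1ℚ :+ con 1ℚ) :* t) :+ (con 1ℚ :+ con 1ℚ) :* t := con 1ℚ) refl t))
    where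
    i = lookup x k
    t = R.fromℕ (i ℕ.⊓ M) ℚ.* ι

  η : ℚ
  η = 2ℚ ℚ.* (D ℚ.* ι)

  0≤η : 0ℚ ℚ.≤ η
  0≤η = *-nonNeg 0≤2 (*-nonNeg 0≤D 0≤ι)

  node-close : ∀ i j → i ℕ.≤ j → j ℕ.≤ d ℕ.+ i → ℚ.∣ node i ℚ.- node j ∣ ℚ.≤ η
  node-close i j i≤j j≤d+i = ∣p∣≤q
    (≤-cert (+-nonNeg 0≤η (*-nonNeg 0≤2 (*-nonNeg (0≤q-p (R.fromℕ-mono (ℕₚ.⊓-monoˡ-≤ M i≤j))) 0≤ι)))
      (solve 4 (λ a b D ι → ((:- con 1ℚ :+ (con 1ℚ :+ con 1ℚ) :* (a :* ι)) :- (:- con 1ℚ :+ (con 1ℚ :+ con 1ℚ) :* (b :* ι)))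
         :+ ((con 1ℚ :+ con 1ℚ) :* (D :* ι) :+ (con 1ℚ :+ con 1ℚ) :* ((b :- a) :* ι)) := (con 1ℚ :+ con 1ℚ) :* (D :* ι)) refl a b D ι))
    (≤-cert (*-nonNeg 0≤2 (*-nonNeg (0≤q-p b≤D+a) 0≤ι))
      (solve 4 (λ a b D ι → :- ((:- con 1ℚ :+ (con 1ℚ :+ con 1ℚ) :* (a :* ι)) :- (:- con 1ℚ :+ (con 1ℚ :+ con 1ℚ) :* (b :* ι)))
         :+ (con 1ℚ :+ con 1ℚ) :* ((D :+ a :- b) :* ι) := (con 1ℚ :+ con 1ℚ) :* (D :* ι)) refl a b D ι))
    where
    a = R.fromℕ (i ℕ.⊓ M)
    b = R.fromℕ (j ℕ.⊓ M)
    b≤D+a : b ℚ.≤ D ℚ.+ a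
    b≤D+a = ℚₚ.≤-trans (R.fromℕ-mono (ℕₚ.≤-trans (ℕₚ.⊓-monoˡ-≤ M j≤d+i)
      (ℕₚ.≤-trans (ℕₚ.⊓-monoʳ-≤ (d ℕ.+ i) (ℕₚ.m≤n+m M d)) (ℕₚ.≤-reflexive (sym (ℕₚ.+-distribˡ-⊓ d i M))))))
      (ℚₚ.≤-reflexive (fromℕ-+ d (i ℕ.⊓ M)))

  a : Fin d → Vec ℕ d → Bool
  a k x = does (f (grid x) k ℚₚ.≤? 0ℚ)

  a₀ : ∀ k x → lookup x k ≡ 0 → a k x ≡ false
  a₀ k x xₖ≡0 = dec-false (f (grid x) k ℚₚ.≤? 0ℚ) λ le →
    ℚₚ.<-irrefl refl (ℚₚ.<-≤-trans (f-pos (grid-box x) k (trans (cong node xₖ≡0)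
      (solve 1 (λ ι → :- con 1ℚ :+ (con 1ℚ :+ con 1ℚ) :* (con 0ℚ :* ι) := :- con 1ℚ) refl ι))) le)

  a₁ : ∀ k x → lookup x k ≡ M → a k x ≡ true
  a₁ k x xₖ≡M = dec-true (f (grid x) k ℚₚ.≤? 0ℚ) (f-neg (grid-box x) k (trans (cong node xₖ≡M)
    (trans (cong (λ i → ℚ.- 1ℚ ℚ.+ 2ℚ ℚ.* (R.fromℕ i ℚ.* ι)) (ℕₚ.⊓-idem M))
      (trans (cong (λ t → ℚ.- 1ℚ ℚ.+ 2ℚ ℚ.* t) Mι≡1) refl))))

  miranda : ∃ λ x → ∀ k → Changes x d (a k)
  miranda = poincaré-miranda M a a₀ a₁

  x : Vec ℕ d
  x = proj₁ miranda

  t : ℚ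
  t = K ℚ.* η

  0≤t : 0ℚ ℚ.≤ t
  0≤t = *-nonNeg 0≤K 0≤η

  t-small : (1ℚ ℚ.+ D) ℚ.* t ℚ.≤ 1ℚ
  t-small = ℚₚ.≤-trans (ℚₚ.≤-reflexive (solve 3 (λ K D ι → (con 1ℚ :+ D) :* (K :* ((con 1ℚ :+ con 1ℚ) :* (D :* ι)))
      := K :* ((con 1ℚ :+ con 1ℚ) :* D) :* (con 1ℚ :+ D) :* ι) refl K D ι))
    (ℚₚ.≤-trans (ℚₚ.*-monoʳ-≤-nonNeg ι {{ℚ.nonNegative 0≤ι}}
      (ℚₚ.≤-trans (proj₂ enough) (R.fromℕ-mono (ℕₚ.n≤1+n (proj₁ enough))))) (ℚₚ.≤-reflexive Mι≡1))

  f-close : ∀ k y → x ≼[ d ] y → ℚ.∣ f (grid x) k ℚ.- f (grid y) k ∣ ℚ.≤ t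
  f-close k y x≼y = ℚₚ.≤-trans
    (lipschitz (f-lip k) (grid-box x) (grid-box y) 0≤η (λ k → node-close (lookup x k) (lookup y k) (proj₁ (x≼y k)) (proj₂ (x≼y k))))
    (ℚₚ.*-monoʳ-≤-nonNeg η {{ℚ.nonNegative 0≤η}} (term≤∑ (λ k → 0≤slope (f-lip k)) k))

  does-true : ∀ {A : Set} (A? : Dec A) → does A? ≡ true → A
  does-true (yes a) e = a

  does-false : ∀ {A : Set} (A? : Dec A) → does A? ≡ false → ¬ A
  does-false (no ¬a) e = ¬a

  -- Close to `x` there are vertices where coordinate `k` of `f` is positive and where it is not,
  -- and `f` varies by at most `t` on the way to either.
  f≤t : ∀ k → ℚ.∣ 0ℚ ℚ.- f (grid x) k ∣ ℚ.≤ t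
  f≤t k = go (proj₂ miranda k)
    where
    go : Changes x d (a k) → ℚ.∣ 0ℚ ℚ.- f (grid x) k ∣ ℚ.≤ t
    go (y , z , x≼y , x≼z , ay , az) = ∣p∣≤q
      (≤-cert (+-nonNeg (ℚₚ.<⇒≤ (ℚₚ.≰⇒> (does-false (f (grid z) k ℚₚ.≤? 0ℚ) az))) (0≤q-p (∣p∣≤⇒-p≤ (f-close k z x≼z))))
        (solve 3 (λ fx fz t → con 0ℚ :- fx :+ (fz :+ (t :- (:- (fx :- fz)))) := t) refl (f (grid x) k) (f (grid z) k) t))
      (≤-cert (+-nonNeg (0≤q-p (does-true (f (grid y) k ℚₚ.≤? 0ℚ) ay)) (0≤q-p (∣p∣≤⇒p≤ (f-close k y x≼y))))
        (solve 3 (λ fx fy t → :- (con 0ℚ :- fx) :+ ((con 0ℚ :- fy) :+ (t :- (fx :- fy))) := t) refl (f (grid x) k) (f (grid y) k) t))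

  -- The factor `1 + D` in `t-small` yields both t ≤ 1 and Dt ≤ 1, hence Dt² ≤ 1.
  almost-zero : ∃ λ s → Box 1ℚ s × dist² (λ _ → 0ℚ) (f s) ℚ.≤ 1ℚ
  almost-zero = grid x , grid-box x , ℚₚ.≤-trans (norm²-bound f≤t) (ℚₚ.≤-trans
    (≤-cert (+-nonNeg (*-nonNeg (*-nonNeg 0≤D 0≤t) (0≤q-p t≤1)) 0≤t)
      (solve 2 (λ D t → D :* (t :* t) :+ (D :* t :* (con 1ℚ :- t) :+ t) := (con 1ℚ :+ D) :* t) refl D t)) t-small)
    where
    t≤1 : t ℚ.≤ 1ℚ
    t≤1 = ℚₚ.≤-trans (≤-cert (*-nonNeg 0≤D 0≤t) (solve 2 (λ D t → t :+ D :* t := (con 1ℚ :+ D) :* t) refl D t)) t-small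

-- Step is kept abstract because comparing unfolded real inequalities is expensive.
closed-path : ExcludedMiddle 0ℓ → ∀ d n (X : Fin n → Subset d) → (∀ i → OneDense (X i)) →
              (Step : Vector ℚ d → Point d → Point d → Set) →
              (∀ {s P Q p q ε ε′} → Approximates P p ε → Approximates Q q ε′ →
                norm² (λ k → q k ℚ.- p k ℚ.- s k) ℚ.≤ 2ℚ ℚ.- (ε ℚ.+ ε′) → Step s P Q) →
              ∃ λ (p : Fin (suc (suc n)) → Point d) → ∃ λ (s : Vector ℚ d) →
                p zero ≋ origin × p (fromℕ (suc n)) ≋ origin ×
                (∀ i → p (suc (inject₁ i)) ∈ X i) ×
                (∀ i → Step s (p (inject₁ i)) (p (suc i)))
closed-path em d n X dense Step step =
  origin Vector.∷ proj₁ walk , s , (λ k ε 0<ε → 0 , λ _ _ → 0<ε) , proj₂ walk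
  where
  0<reach : 0ℚ ℚ.< reach n
  0<reach = ℚₚ.+-mono-≤-< {0ℚ} {R.fromℕ n} {0ℚ} (0≤fromℕ n) (ℚₚ.+-mono-<-≤ {0ℚ} {1ℚ} {0ℚ} (ℚₚ.positive⁻¹ 1ℚ) (0≤fromℕ n))
  sampling : ∀ i → Coverable (X i) (reach n) (λ _ → 0ℚ)
  sampling i = HeineBorel.coverable em (dense i) 0<reach (λ _ → 0ℚ)
  L : Samplings X
  L i = proj₁ (sampling i)
  cov : CoversBox (reach n) L
  cov i c c≤R = proj₂ (sampling i) c λ k →
    subst (λ t → ℚ.∣ t ∣ ℚ.≤ reach n) (sym (ℚₚ.+-identityʳ (c k))) (c≤R k)
  drift = predict-drift n L cov ℚₚ.≤-refl
  -- The `1 + n` steps outweigh a drift of `n` by 1, so the coordinate is at least 1 here and at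
  -- most -1 in `neg`.
  pos : ∀ {s} → Box 1ℚ s → ∀ k → s k ≡ ℚ.- 1ℚ → 0ℚ ℚ.< predict n L s k
  pos {s} s≤1 k sₖ≡-1 = ℚₚ.<-≤-trans (ℚₚ.positive⁻¹ 1ℚ)
    (≤-cert (0≤q-p (∣p∣≤⇒-p≤ (subst (λ t → ℚ.∣ predict n L s k ℚ.+ (1ℚ ℚ.+ R.fromℕ n) ℚ.* t ∣ ℚ.≤ R.fromℕ n) sₖ≡-1 (drift s≤1 k))))
      (solve 2 (λ c n → con 1ℚ :+ (n :- (:- (c :+ (con 1ℚ :+ n) :* (:- con 1ℚ)))) := c) refl (predict n L s k) (R.fromℕ n)))
  neg : ∀ {s} → Box 1ℚ s → ∀ k → s k ≡ 1ℚ → predict n L s k ℚ.≤ 0ℚ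
  neg {s} s≤1 k sₖ≡1 =
    ≤-cert (+-nonNeg 0≤1 (0≤q-p (∣p∣≤⇒p≤ (subst (λ t → ℚ.∣ predict n L s k ℚ.+ (1ℚ ℚ.+ R.fromℕ n) ℚ.* t ∣ ℚ.≤ R.fromℕ n) sₖ≡1 (drift s≤1 k)))))
      (solve 2 (λ c n → c :+ (con 1ℚ :+ (n :- (c :+ (con 1ℚ :+ n) :* con 1ℚ))) := con 0ℚ) refl (predict n L s k) (R.fromℕ n))
  zero-of-predict = Zero.almost-zero (predict-lip n L cov ℚₚ.≤-refl) pos neg
  s = proj₁ zero-of-predict
  walk = path n L cov ℚₚ.≤-refl (proj₁ (proj₂ zero-of-predict)) (Step s) step
    (embed-approximates (λ _ → 0ℚ)) (proj₂ (proj₂ zero-of-predict))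

theorem3 : ExcludedMiddle 0ℓ →
    (d : ℕ) .{{_ : NonZero d}} (n-1 : ℕ)
    (X : Fin n-1 → Subset d) → (∀ i → OneDense (X i)) →
    ∃ λ (p : Fin (suc (suc n-1)) → Point d) → ∃ λ (s : Point d) →
    p zero ≋ origin ×
    p (fromℕ (suc n-1)) ≋ origin ×
    ((i : Fin n-1) → p (suc (inject₁ i)) ∈ X i) ×
    ((i : Fin (suc n-1)) → ‖ (p (suc i) ⊖ p (inject₁ i)) ⊖ s ‖ ≤ √ 2ℝ)
theorem3 em d n X dense =
  let p , s , start , end , members , steps = closed-path em d n X dense
        (λ s P Q → ‖ (Q ⊖ P) ⊖ embed s ‖ ≤ √ 2ℝ)
        (λ {s} {P} {Q} {p} {q} {ε} {ε′} → step≤√2 {P = P} {Q} {p} {q} {ε} {ε′} s)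
  in p , embed s , start , end , members , steps
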